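{- For every even $d\ge 2$ and every $n\ge1$, $$\det_d(\mathsf M^{(d)}_n)=\pm\left(\prod_{i=0}^{n-1}\frac{(n+i)!}{i!}\right)^{\frac d2-1}.$$
   Context: For an $n\times n$ matrix $X=(X_{ij})$, the shifted iterated matrix multiplication tensor $\mathsf M^{(d)}_X$ is the hypermatrix with $d$ modes, each indexed by pairs $(i,j)\in[n]^2$, with entries $(\mathsf M^{(d)}_X)_{(i_1,j_1),\dots,(i_d,j_d)}=\delta_{j_1=i_2}\delta_{j_2=i_3}\cdots\delta_{j_{d-1}=i_d}\,X_{i_1j_d}$ (equivalently, as a multilinear form on $d$-tuples of $n\times n$ matrices, $(A_1,\dots,A_d)\mapsto\mathrm{Tr}(X^tA_1\cdots A_d)$). Set $\mathsf M^{(d)}_n:=\mathsf M^{(d)}_{I_n}$. For a hypermatrix $X$ with $d$ modes each indexed by an $N$-element set (identified with $[N]$ by a fixed bijection, the same in all modes), the combinatorial hyperdeterminant is $\det_d(X)=\frac1{N!}\sum_{\sigma_1,\dots,\sigma_d\in S_N}\mathrm{sgn}(\sigma_1)\cdots\mathrm{sgn}(\sigma_d)\prod_{i=1}^N X_{\sigma_1(i),\dots,\sigma_d(i)}$. -}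

module Defs where

open import Data.Bool using (Bool; true; false; _∧_; not)
open import Data.Nat as ℕ using (ℕ; zero; suc; _!; NonZero)
open import Data.Nat.Properties using (_!≢0)
open import Data.Fin as Fin using (Fin; remQuot; toℕ)
open import Data.Fin.Properties using (_≟_)
open import Data.Integer as ℤ using (ℤ; +_; -[1+_])
open import Data.Rational as ℚ using (ℚ; 1ℚ)
open import Data.List as List using (List; []; _∷_; allFin; filterᵇ; concatMap; map; foldr; length)
open import Data.Vec as Vec using (Vec; []; _∷_; lookup)
open import Data.Product using (_×_; _,_; proj₁; proj₂)
open import Relation.Nullary.Decidable using (does)

sumℤ : List ℤ → ℤ
sumℤ = foldr ℤ._+_ (+ 0)

prodℤ : List ℤ → ℤ
prodℤ = foldr ℤ._*_ (+ 1)

prodℚ : List ℚ → ℚ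
prodℚ = foldr ℚ._*_ 1ℚ

powℚ : ℚ → ℕ → ℚ
powℚ q zero    = 1ℚ
powℚ q (suc k) = q ℚ.* powℚ q k

allVecs : (k m : ℕ) → List (Vec (Fin k) m)
allVecs k zero    = [] ∷ []
allVecs k (suc m) = concatMap (λ x → map (x ∷_) (allVecs k m)) (allFin k)

_<ᶠ_ : ∀ {N} → Fin N → Fin N → Bool
a <ᶠ b = toℕ a ℕ.<ᵇ toℕ b

orderedPairs : (N : ℕ) → List (Fin N × Fin N)
orderedPairs N = filterᵇ (λ p → proj₁ p <ᶠ proj₂ p)
                   (List.cartesianProduct (allFin N) (allFin N))

isInjective : ∀ {N} → Vec (Fin N) N → Bool
isInjective {N} v =
  foldr _∧_ true (map (λ p → not (does (lookup v (proj₁ p) ≟ lookup v (proj₂ p))))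
                      (orderedPairs N))

SymList : (N : ℕ) → List (Vec (Fin N) N)
SymList N = filterᵇ isInjective (allVecs N N)

inversions : ∀ {N} → Vec (Fin N) N → ℕ
inversions {N} v =
  length (filterᵇ (λ p → lookup v (proj₂ p) <ᶠ lookup v (proj₁ p)) (orderedPairs N))

sgn : ∀ {N} → Vec (Fin N) N → ℤ
sgn v = (ℤ.- (+ 1)) ℤ.^ inversions v

Hypermatrix : (d N : ℕ) → Set
Hypermatrix d N = Vec (Fin N) d → ℤ

tuples : ∀ {A : Set} → List A → (d : ℕ) → List (Vec A d)
tuples xs zero    = [] ∷ []
tuples xs (suc d) = concatMap (λ x → map (x ∷_) (tuples xs d)) xs

hyperdet : (d N : ℕ) → Hypermatrix d N → ℚ
hyperdet d N X =
  ℚ._/_ (sumℤ (map term (tuples (SymList N) d))) (N !) {{N !≢0}}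
  where
  term : Vec (Vec (Fin N) N) d → ℤ
  term σs = prodℤ (Vec.toList (Vec.map sgn σs))
            ℤ.* prodℤ (map (λ i → X (Vec.map (λ σ → lookup σ i) σs)) (allFin N))

δ : ∀ {n} → Fin n → Fin n → ℤ
δ a b with does (a ≟ b)
... | true  = + 1
... | false = + 0

chainδ : ∀ {n m} → Fin n → Vec (Fin n × Fin n) m → ℤ
chainδ j []             = + 1
chainδ j ((i' , j') ∷ ps) = δ j i' ℤ.* chainδ j' ps

lastJ : ∀ {n m} → Fin n → Vec (Fin n × Fin n) m → Fin n
lastJ j []             = j
lastJ j ((_ , j') ∷ ps) = lastJ j' ps

Mpairs : ∀ {n d} → (Fin n → Fin n → ℤ) → Vec (Fin n × Fin n) d → ℤ
Mpairs X []               = + 0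
Mpairs X ((i₁ , j₁) ∷ ps) = chainδ j₁ ps ℤ.* X i₁ (lastJ j₁ ps)

-- as a hypermatrix with modes indexed by Fin (n * n), via the fixed
-- bijection Fin (n * n) ≅ Fin n × Fin n (remQuot), the same in every mode
MX : (d n : ℕ) → (Fin n → Fin n → ℤ) → Hypermatrix d (n ℕ.* n)
MX d n X idx = Mpairs X (Vec.map (remQuot {n} n) idx)

identity : (n : ℕ) → Fin n → Fin n → ℤ
identity n = δ

Mn : (d n : ℕ) → Hypermatrix d (n ℕ.* n)
Mn d n = MX d n (identity n)

hookProd : ℕ → ℚ
hookProd n = prodℚ (map (λ i → ℚ._/_ (+ ((n ℕ.+ i) !)) (i !) {{i !≢0}}) (List.upTo n))

{-# OPTIONS --safe #-}

-- Put N = n² and let W be the matrix indexed by words I, J : [N] → [n] whose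
-- entry is the sign of k ↦ (I k , J k), or 0 if that map is not a bijection onto
-- [n]². Then N! det_d = tr (W^d), and Wᵗ = ± W. As W Wᵗ W is antisymmetric under
-- simultaneous permutations of its two words, it is a multiple c W of W; since
-- tr (W Wᵗ) = N!, this gives det_d = ± c^(d/2 - 1).
--
-- The scalar c is a signed sum over row permutations and column permutations of
-- an n × n array, evaluated one column at a time. Each column contributes the
-- analogue of Cayley's identity Ω det^s = s (s+1) ⋯ (s+n-1) det^(s-1), proved as
-- in Capelli's identity from the invariance of determinants under sl n: moving a
-- letter along a transposition costs a factor -1/s, so a signed sum over
-- permutations becomes the cycle generating function of the symmetric group.
module Submission where

-- Permutations never form a type of their own: signed sums run over all maps, and the sign vanishes
-- off the bijections, so that sums can be split one coordinate at a time.
--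
-- The row and column permutations arise from evaluating `W Wᵗ W` at the identity of the square.
-- There one outer factor admits only words that permute each row, the other only words that permute
-- each column. Aligning the middle factor makes the row signs occur squared, while the column signs
-- survive: this is the Young symmetrizer of a square, applied to a power of the determinant.
--
-- The columns cannot be treated independently, because the row permutations mix them. The induction
-- therefore takes an arbitrary sl n invariant function in place of the power of the determinant:
-- contracting one cell per row against a determinant leaves an invariant function with one column
-- fewer. Invariance supplies only linear relations over the integers, so the factor -1/s is handled
-- with denominators cleared.

module Development where
  open import Defs
  open import Algebra.Bundles using (CommutativeRing)
  open import Algebra.Structures using (IsCommutativeRing)
  import Algebra.Properties.CommutativeMonoid.Sum as CommutativeMonoidSum
  import Algebra.Properties.Ring as RingProperties
  open import Data.Bool using (Bool; true; false; if_then_else_; _∧_; not)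
  open import Data.Empty using (⊥-elim)
  open import Data.Fin as Fin using (Fin; zero; suc; punchIn; punchOut; combine; remQuot; _↑ˡ_; _↑ʳ_)
  open import Data.Fin.Permutation using (Permutation; permutation)
  open import Data.Fin.Permutation.Components using (transpose; transpose-inverse)
  open import Data.Fin.Properties as Finₚ using (_≟_; suc-injective; any?; punchOut-injective; <⇒notInjective; pigeonhole; remQuot-combine; combine-remQuot)
  open import Data.Integer as ℤ using (ℤ; 0ℤ; 1ℤ)
  import Data.Integer.Properties as ℤₚ
  open import Data.List as List using (List; []; _∷_; map; concatMap; allFin; filterᵇ; length; _++_)
  open import Data.List.Properties using (map-cong; map-∘; map-tabulate; map-++; upTo-∷ʳ)
  open import Data.Nat as ℕ using (ℕ; zero; suc; _!)
  import Data.Nat.Properties as ℕₚ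
  open import Data.Nat.Properties using (_!≢0)
  open import Data.Product using (_×_; _,_; proj₁; proj₂; ∃; ∃₂)
  open import Data.Rational as ℚ using (ℚ)
  import Data.Rational.Properties as ℚₚ
  open import Data.Rational.Unnormalised using (mkℚᵘ; *≡*)
  import Data.Rational.Unnormalised.Properties as ℚᵘₚ
  open import Data.Sum using (_⊎_; inj₁; inj₂)
  open import Data.Vec as Vec using (Vec; lookup)
  open import Data.Vec.Functional as F using ()
  open import Data.Vec.Functional.Properties using (insertAt-lookup; insertAt-punchIn; updateAt-updates; updateAt-minimal)
  open import Function using (_∘_; id)
  import Level
  open import Relation.Binary.PropositionalEquality hiding ([_])
  open import Relation.Nullary using (Dec; yes; no; does; ¬_)
  open import Relation.Nullary.Decidable using (map′; _×-dec_)
  open ≡-Reasoning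

  private variable
    A B : Set
    m n k s : ℕ

  -- Sealed, because the unfolding of integer multiplication blocks unification.
  opaque
    infixl 6 _+_
    infixl 7 _*_
    infix  8 -_
    _+_ _*_ : ℤ → ℤ → ℤ
    _+_ = ℤ._+_
    _*_ = ℤ._*_
    -_ : ℤ → ℤ
    -_ = ℤ.-_

    ι : ℕ → ℤ
    ι k = ℤ.+ k

    ι-1 : ι 1 ≡ 1ℤ
    ι-1 = refl

    ι-0 : ι 0 ≡ 0ℤ
    ι-0 = refl

    ι-+ : ∀ k l → ι (k ℕ.+ l) ≡ ι k + ι l
    ι-+ k l = refl

    ι-* : ∀ k l → ι (k ℕ.* l) ≡ ι k * ι l
    ι-* = ℤₚ.pos-*

    ι-cancelˡ : ∀ k .{{_ : ℕ.NonZero k}} x y → ι k * x ≡ ι k * y → x ≡ y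
    ι-cancelˡ (suc k) x y = ℤₚ.*-cancelˡ-≡ (ℤ.+ suc k) x y

    self-neg⇒0 : ∀ x → x ≡ - x → x ≡ 0ℤ
    self-neg⇒0 (ℤ.+ zero) eq = refl

    isCommutativeRing : IsCommutativeRing _≡_ _+_ _*_ -_ 0ℤ 1ℤ
    isCommutativeRing = ℤₚ.+-*-isCommutativeRing

  ℤ-ring : CommutativeRing Level.zero Level.zero
  ℤ-ring = record { isCommutativeRing = isCommutativeRing }

  open IsCommutativeRing isCommutativeRing
    using (+-assoc; +-comm; +-identityˡ; +-identityʳ; *-assoc; *-comm;
           *-identityˡ; *-identityʳ; zeroˡ; zeroʳ; distribˡ; distribʳ; -‿inverseʳ)
  open RingProperties (CommutativeRing.ring ℤ-ring)
    using (-‿distribˡ-*; -‿distribʳ-*; -1*x≈-x; -‿involutive; -0#≈0#)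

  -- Indicators and finite sums over enumerated types

  ⟦_⟧ : ∀ {P : Set} → Dec P → ℤ
  ⟦ d ⟧ = if does d then 1ℤ else 0ℤ

  ⟦⟧-cong : ∀ {P Q : Set} {f g : ℤ} (p : Dec P) (q : Dec Q) →
            (P → Q) → (Q → P) → (P → f ≡ g) → ⟦ p ⟧ * f ≡ ⟦ q ⟧ * g
  ⟦⟧-cong (yes p) (yes q) to from eq = cong (1ℤ *_) (eq p)
  ⟦⟧-cong (yes p) (no ¬q) to from eq = ⊥-elim (¬q (to p))
  ⟦⟧-cong (no ¬p) (yes q) to from eq = ⊥-elim (¬p (from q))
  ⟦⟧-cong (no ¬p) (no ¬q) to from eq = trans (zeroˡ _) (sym (zeroˡ _))

  ⟦⟧-yes : ∀ {P : Set} {f : ℤ} (p : Dec P) → P → ⟦ p ⟧ * f ≡ f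
  ⟦⟧-yes (yes _) p = *-identityˡ _
  ⟦⟧-yes (no ¬p) p = ⊥-elim (¬p p)

  ⟦⟧-no : ∀ {P : Set} {f : ℤ} (p : Dec P) → ¬ P → ⟦ p ⟧ * f ≡ 0ℤ
  ⟦⟧-no (yes p) ¬p = ⊥-elim (¬p p)
  ⟦⟧-no (no _)  ¬p = zeroˡ _

  Σₗ : List A → (A → ℤ) → ℤ
  Σₗ xs f = List.foldr _+_ 0ℤ (map f xs)

  Σₗ-++ : ∀ xs ys (f : A → ℤ) → Σₗ (xs ++ ys) f ≡ Σₗ xs f + Σₗ ys f
  Σₗ-++ []       ys f = sym (+-identityˡ _)
  Σₗ-++ (x ∷ xs) ys f = trans (cong (f x +_) (Σₗ-++ xs ys f)) (sym (+-assoc (f x) _ _))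

  Σₗ-concatMap : ∀ (g : A → List B) xs (f : B → ℤ) →
                 Σₗ (concatMap g xs) f ≡ Σₗ xs (λ x → Σₗ (g x) f)
  Σₗ-concatMap g []       f = refl
  Σₗ-concatMap g (x ∷ xs) f =
    trans (Σₗ-++ (g x) _ f) (cong (_ +_) (Σₗ-concatMap g xs f))

  Σₗ-map : ∀ (g : A → B) xs (f : B → ℤ) → Σₗ (map g xs) f ≡ Σₗ xs (f ∘ g)
  Σₗ-map g xs f = cong (List.foldr _+_ 0ℤ) (sym (map-∘ xs))

  Σₗ-cong : ∀ (xs : List A) {f g : A → ℤ} → (∀ x → f x ≡ g x) → Σₗ xs f ≡ Σₗ xs g
  Σₗ-cong xs eq = cong (List.foldr _+_ 0ℤ) (map-cong eq xs)

  -- A small universe of finite index types. Each code determines a decidable pointwise equality and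
  -- a list of elements, so letters, words, families of words and pairs share one principle of
  -- substitution.
  data Enum : Set → Set₁ where
    fin : ∀ n → Enum (Fin n)
    fun : ∀ {A} m → Enum A → Enum (Fin m → A)
    _⊗_ : ∀ {A B} → Enum A → Enum B → Enum (A × B)

  infixr 4 _⊗_

  Eq : Enum A → A → A → Set
  Eq (fin n)   x y = x ≡ y
  Eq (fun m E) v w = ∀ i → Eq E (v i) (w i)
  Eq (E ⊗ E′)  (x , y) (x′ , y′) = Eq E x x′ × Eq E′ y y′

  -- In the absence of function extensionality, a summand over maps must be shown to
  -- respect pointwise equality.
  Cong : Enum A → (A → ℤ) → Set
  Cong E h = ∀ {x y} → Eq E x y → h x ≡ h y

  Eq-refl : ∀ (E : Enum A) x → Eq E x x
  Eq-refl (fin n)   x = refl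
  Eq-refl (fun m E) v i = Eq-refl E (v i)
  Eq-refl (E ⊗ E′)  (x , y) = Eq-refl E x , Eq-refl E′ y

  ∀-dec : ∀ {m} {P : Fin m → Set} → (∀ i → Dec (P i)) → Dec (∀ i → P i)
  ∀-dec {zero}  d = yes λ ()
  ∀-dec {suc m} d = map′ (λ where (p , q) zero → p
                                  (p , q) (suc i) → q i)
                         (λ p → p zero , p ∘ suc)
                         (d zero ×-dec ∀-dec (d ∘ suc))

  eq? : ∀ (E : Enum A) x y → Dec (Eq E x y)
  eq? (fin n)   x y = x ≟ y
  eq? (fun m E) v w = ∀-dec (λ i → eq? E (v i) (w i))
  eq? (E ⊗ E′)  (x , y) (x′ , y′) = eq? E x x′ ×-dec eq? E′ y y′

  functions : ∀ m → List A → List (Fin m → A)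
  functions zero    xs = F.[] ∷ []
  functions (suc m) xs = concatMap (λ x → map (x F.∷_) (functions m xs)) xs

  elems : Enum A → List A
  elems (fin n)   = allFin n
  elems (fun m E) = functions m (elems E)
  elems (E ⊗ E′)  = concatMap (λ x → map (x ,_) (elems E′)) (elems E)

  interchange : ∀ a b c d → (a + b) + (c + d) ≡ (a + c) + (b + d)
  interchange a b c d = begin
    a + b + (c + d)   ≡⟨ +-assoc a b _ ⟩
    a + (b + (c + d)) ≡⟨ cong (a +_) (sym (+-assoc b c d)) ⟩
    a + (b + c + d)   ≡⟨ cong (λ z → a + (z + d)) (+-comm b c) ⟩
    a + (c + b + d)   ≡⟨ cong (a +_) (+-assoc c b d) ⟩
    a + (c + (b + d)) ≡⟨ +-assoc a c _ ⟨
    a + c + (b + d)   ∎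

  Σₗ-zero : ∀ (xs : List A) {f : A → ℤ} → (∀ x → f x ≡ 0ℤ) → Σₗ xs f ≡ 0ℤ
  Σₗ-zero []       eq = refl
  Σₗ-zero (x ∷ xs) eq = trans (cong₂ _+_ (eq x) (Σₗ-zero xs eq)) (+-identityˡ 0ℤ)

  Σₗ-+ : ∀ (xs : List A) (f g : A → ℤ) → Σₗ xs (λ x → f x + g x) ≡ Σₗ xs f + Σₗ xs g
  Σₗ-+ []       f g = sym (+-identityˡ 0ℤ)
  Σₗ-+ (x ∷ xs) f g =
    trans (cong (f x + g x +_) (Σₗ-+ xs f g)) (interchange (f x) (g x) _ _)

  Σₗ-*ˡ : ∀ (xs : List A) c (f : A → ℤ) → Σₗ xs (λ x → c * f x) ≡ c * Σₗ xs f
  Σₗ-*ˡ []       c f = sym (zeroʳ c)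
  Σₗ-*ˡ (x ∷ xs) c f = trans (cong (c * f x +_) (Σₗ-*ˡ xs c f)) (sym (distribˡ c _ _))

  Σₗ-comm : ∀ (xs : List A) (ys : List B) (f : A → B → ℤ) →
            Σₗ xs (λ x → Σₗ ys (f x)) ≡ Σₗ ys (λ y → Σₗ xs (λ x → f x y))
  Σₗ-comm []       ys f = sym (Σₗ-zero ys (λ _ → refl))
  Σₗ-comm (x ∷ xs) ys f =
    trans (cong (Σₗ ys (f x) +_) (Σₗ-comm xs ys f)) (sym (Σₗ-+ ys (f x) _))

  Σₗ-fin : ∀ n (f : Fin (suc n) → ℤ) →
           Σₗ (allFin (suc n)) f ≡ f zero + Σₗ (allFin n) (f ∘ suc)
  Σₗ-fin n f = cong (λ xs → f zero + List.foldr _+_ 0ℤ xs)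
    (trans (map-tabulate suc f) (sym (map-tabulate id (f ∘ suc))))

  opaque
    ∑ : Enum A → (A → ℤ) → ℤ
    ∑ E f = Σₗ (elems E) f

    ∑-cong : ∀ (E : Enum A) {f g : A → ℤ} → (∀ x → f x ≡ g x) → ∑ E f ≡ ∑ E g
    ∑-cong E eq = Σₗ-cong (elems E) eq

    ∑-zero : ∀ (E : Enum A) {f : A → ℤ} → (∀ x → f x ≡ 0ℤ) → ∑ E f ≡ 0ℤ
    ∑-zero E = Σₗ-zero (elems E)

    ∑-+ : ∀ (E : Enum A) (f g : A → ℤ) → ∑ E (λ x → f x + g x) ≡ ∑ E f + ∑ E g
    ∑-+ E = Σₗ-+ (elems E)

    ∑-*ˡ : ∀ (E : Enum A) c (f : A → ℤ) → ∑ E (λ x → c * f x) ≡ c * ∑ E f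
    ∑-*ˡ E = Σₗ-*ˡ (elems E)

    ∑-comm : ∀ (E : Enum A) (E′ : Enum B) (f : A → B → ℤ) →
             ∑ E (λ x → ∑ E′ (f x)) ≡ ∑ E′ (λ y → ∑ E (λ x → f x y))
    ∑-comm E E′ = Σₗ-comm (elems E) (elems E′)

    ∑-fin₀ : ∀ (f : Fin 0 → ℤ) → ∑ (fin 0) f ≡ 0ℤ
    ∑-fin₀ f = refl

    ∑-fin : ∀ n (f : Fin (suc n) → ℤ) → ∑ (fin (suc n)) f ≡ f zero + ∑ (fin n) (f ∘ suc)
    ∑-fin = Σₗ-fin

    ∑-fun₀ : ∀ (E : Enum A) (h : (Fin 0 → A) → ℤ) → ∑ (fun 0 E) h ≡ h F.[]
    ∑-fun₀ E h = +-identityʳ _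

    ∑-fun : ∀ (E : Enum A) (h : (Fin (suc m) → A) → ℤ) →
            ∑ (fun (suc m) E) h ≡ ∑ E (λ x → ∑ (fun m E) (λ v → h (x F.∷ v)))
    ∑-fun {m = m} E h =
      trans (Σₗ-concatMap _ (elems E) h)
            (Σₗ-cong (elems E) (λ x → Σₗ-map (x F.∷_) (functions m (elems E)) h))

    ∑-⊗ : ∀ (E : Enum A) (E′ : Enum B) (h : A × B → ℤ) →
          ∑ (E ⊗ E′) h ≡ ∑ E (λ x → ∑ E′ (λ y → h (x , y)))
    ∑-⊗ E E′ h = trans (Σₗ-concatMap _ (elems E) h)
                       (Σₗ-cong (elems E) (λ x → Σₗ-map (x ,_) (elems E′) h))

  ∑-*ʳ : ∀ (E : Enum A) c (f : A → ℤ) → ∑ E (λ x → f x * c) ≡ ∑ E f * c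
  ∑-*ʳ E c f = trans (∑-cong E (λ x → *-comm (f x) c)) (trans (∑-*ˡ E c f) (*-comm c _))

  ∑-neg : ∀ (E : Enum A) (f : A → ℤ) → ∑ E (λ x → - f x) ≡ - ∑ E f
  ∑-neg E f = trans (∑-cong E (λ x → sym (-1*x≈-x (f x)))) (trans (∑-*ˡ E (- 1ℤ) f) (-1*x≈-x _))

  ⟦⟧-× : ∀ {P Q : Set} (p : Dec P) (q : Dec Q) f → ⟦ p ×-dec q ⟧ * f ≡ ⟦ p ⟧ * (⟦ q ⟧ * f)
  ⟦⟧-× (yes _) q f = sym (*-identityˡ _)
  ⟦⟧-× (no _)  q f = trans (zeroˡ f) (sym (zeroˡ _))

  ∑-fin-pick : ∀ n (h : Fin n → ℤ) y → ∑ (fin n) (λ x → ⟦ x ≟ y ⟧ * h x) ≡ h y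
  ∑-fin-pick (suc n) h zero = begin
    ∑ (fin (suc n)) (λ x → ⟦ x ≟ zero ⟧ * h x)
      ≡⟨ ∑-fin n _ ⟩
    1ℤ * h zero + ∑ (fin n) (λ x → 0ℤ * h (suc x))
      ≡⟨ cong₂ _+_ (*-identityˡ _) (∑-zero (fin n) (λ _ → zeroˡ _)) ⟩
    h zero + 0ℤ
      ≡⟨ +-identityʳ _ ⟩
    h zero ∎
  ∑-fin-pick (suc n) h (suc y) =
    trans (∑-fin n _) (trans (cong₂ _+_ (zeroˡ _) (∑-fin-pick n (h ∘ suc) y)) (+-identityˡ _))

  ∑-pick : ∀ (E : Enum A) h → Cong E h → ∀ y → ∑ E (λ x → ⟦ eq? E x y ⟧ * h x) ≡ h y
  ∑-pick (fin n) h hc y = ∑-fin-pick n h y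
  ∑-pick (fun zero E) h hc w = trans (∑-fun₀ E _) (trans (*-identityˡ _) (hc λ ()))
  ∑-pick (fun (suc m) E) h hc w = begin
    ∑ (fun (suc m) E) (λ v → ⟦ eq? (fun (suc m) E) v w ⟧ * h v)
      ≡⟨ ∑-fun E _ ⟩
    ∑ E (λ x → ∑ (fun m E) (λ v →
      ⟦ eq? E x (w zero) ×-dec eq? (fun m E) v (w ∘ suc) ⟧ * h (x F.∷ v)))
      ≡⟨ ∑-cong E (λ x → trans (∑-cong (fun m E)
           (λ v → ⟦⟧-× (eq? E x (w zero)) (eq? (fun m E) v (w ∘ suc)) _)) (∑-*ˡ (fun m E) _ _)) ⟩
    ∑ E (λ x → ⟦ eq? E x (w zero) ⟧ * ∑ (fun m E) (λ v →
      ⟦ eq? (fun m E) v (w ∘ suc) ⟧ * h (x F.∷ v)))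
      ≡⟨ ∑-cong E (λ x → cong (⟦ eq? E x (w zero) ⟧ *_)
           (∑-pick (fun m E) (λ v → h (x F.∷ v))
              (λ eq → hc (λ { zero → Eq-refl E x ; (suc i) → eq i })) (w ∘ suc))) ⟩
    ∑ E (λ x → ⟦ eq? E x (w zero) ⟧ * h (x F.∷ (w ∘ suc)))
      ≡⟨ ∑-pick E (λ x → h (x F.∷ (w ∘ suc)))
           (λ p → hc (λ { zero → p ; (suc i) → Eq-refl E (w (suc i)) })) (w zero) ⟩
    h (w zero F.∷ (w ∘ suc))
      ≡⟨ hc (λ { zero → Eq-refl E (w zero) ; (suc i) → Eq-refl E (w (suc i)) }) ⟩
    h w ∎
  ∑-pick (E ⊗ E′) h hc (x′ , y′) = begin
    ∑ (E ⊗ E′) (λ z → ⟦ eq? (E ⊗ E′) z (x′ , y′) ⟧ * h z)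
      ≡⟨ ∑-⊗ E E′ _ ⟩
    ∑ E (λ x → ∑ E′ (λ y → ⟦ eq? E x x′ ×-dec eq? E′ y y′ ⟧ * h (x , y)))
      ≡⟨ ∑-cong E (λ x → trans (∑-cong E′ (λ y → ⟦⟧-× (eq? E x x′) (eq? E′ y y′) _)) (∑-*ˡ E′ _ _)) ⟩
    ∑ E (λ x → ⟦ eq? E x x′ ⟧ * ∑ E′ (λ y → ⟦ eq? E′ y y′ ⟧ * h (x , y)))
      ≡⟨ ∑-cong E (λ x → cong (⟦ eq? E x x′ ⟧ *_)
           (∑-pick E′ (λ y → h (x , y)) (λ p → hc (Eq-refl E x , p)) y′)) ⟩
    ∑ E (λ x → ⟦ eq? E x x′ ⟧ * h (x , y′))
      ≡⟨ ∑-pick E (λ x → h (x , y′)) (λ p → hc (p , Eq-refl E′ y′)) x′ ⟩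
    h (x′ , y′) ∎

  -- That `f` and `g` are inverse is expressed as the equivalence of `y = f x` and `x = g y`. The
  -- indicator of the first is inserted under a sum over `y`, the sums are exchanged, and the
  -- indicator of the second picks out the term.
  ∑-bij : ∀ (E : Enum A) (E′ : Enum B) (f : A → B) (g : B → A) →
          (∀ x y → Eq E′ y (f x) → Eq E x (g y)) → (∀ x y → Eq E x (g y) → Eq E′ y (f x)) →
          ∀ h → Cong E′ h → ∑ E (h ∘ f) ≡ ∑ E′ h
  ∑-bij E E′ f g to from h hc = begin
    ∑ E (h ∘ f)
      ≡⟨ ∑-cong E (λ x → sym (∑-pick E′ h hc (f x))) ⟩
    ∑ E (λ x → ∑ E′ (λ y → ⟦ eq? E′ y (f x) ⟧ * h y))
      ≡⟨ ∑-comm E E′ _ ⟩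
    ∑ E′ (λ y → ∑ E (λ x → ⟦ eq? E′ y (f x) ⟧ * h y))
      ≡⟨ ∑-cong E′ (λ y → ∑-cong E (λ x →
           ⟦⟧-cong (eq? E′ y (f x)) (eq? E x (g y)) (to x y) (from x y) (λ _ → refl))) ⟩
    ∑ E′ (λ y → ∑ E (λ x → ⟦ eq? E x (g y) ⟧ * h y))
      ≡⟨ ∑-cong E′ (λ y → ∑-pick E (λ _ → h y) (λ _ → refl) (g y)) ⟩
    ∑ E′ h ∎

  -- Signs of maps between finite sets

  open CommutativeMonoidSum (CommutativeRing.*-commutativeMonoid ℤ-ring)
    renaming (sum to ∏; sum-cong-≗ to ∏-cong; ∑-distrib-+ to ∏-*; ∑-comm to ∏-comm;
              sum-remove to ∏-remove; sum-permute to ∏-permute)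
    using (sum-replicate-zero)

  ∏-one : ∀ n {f : Fin n → ℤ} → (∀ i → f i ≡ 1ℤ) → ∏ f ≡ 1ℤ
  ∏-one n eq = trans (∏-cong eq) (sum-replicate-zero n)

  *-interchange : ∀ a b c d → (a * b) * (c * d) ≡ (a * c) * (b * d)
  *-interchange a b c d = begin
    a * b * (c * d)   ≡⟨ *-assoc a b _ ⟩
    a * (b * (c * d)) ≡⟨ cong (a *_) (sym (*-assoc b c d)) ⟩
    a * (b * c * d)   ≡⟨ cong (λ z → a * (z * d)) (*-comm b c) ⟩
    a * (c * b * d)   ≡⟨ cong (a *_) (*-assoc c b d) ⟩
    a * (c * (b * d)) ≡⟨ *-assoc a c _ ⟨
    a * c * (b * d)   ∎

  neg*neg : ∀ a b → - a * - b ≡ a * b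
  neg*neg a b = begin
    - a * - b   ≡⟨ -‿distribˡ-* a (- b) ⟨
    - (a * - b) ≡⟨ cong -_ (sym (-‿distribʳ-* a b)) ⟩
    - - (a * b) ≡⟨ -‿involutive _ ⟩
    a * b       ∎

  -- The sign of `y - x`. Its value 0 on equal arguments makes products of it vanish at collisions
  -- without a case distinction.
  sg : Fin n → Fin n → ℤ
  sg zero    zero    = 0ℤ
  sg zero    (suc _) = 1ℤ
  sg (suc _) zero    = - 1ℤ
  sg (suc x) (suc y) = sg x y

  sg-diag : ∀ (x : Fin n) → sg x x ≡ 0ℤ
  sg-diag zero    = refl
  sg-diag (suc x) = sg-diag x

  sg-anti : ∀ (x y : Fin n) → sg x y ≡ - sg y x
  sg-anti zero    zero    = sym -0#≈0#
  sg-anti zero    (suc y) = sym (-‿involutive 1ℤ)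
  sg-anti (suc x) zero    = refl
  sg-anti (suc x) (suc y) = sg-anti x y

  sg-sq : ∀ (x y : Fin n) → x ≢ y → sg x y * sg x y ≡ 1ℤ
  sg-sq zero    zero    x≢y = ⊥-elim (x≢y refl)
  sg-sq zero    (suc y) x≢y = *-identityˡ 1ℤ
  sg-sq (suc x) zero    x≢y = trans (neg*neg 1ℤ 1ℤ) (*-identityˡ 1ℤ)
  sg-sq (suc x) (suc y) x≢y = sg-sq x y (x≢y ∘ cong suc)

  -- The sign of a permutation, and 0 on maps that are not injective.
  E : (Fin m → Fin n) → ℤ
  E {zero}  v = 1ℤ
  E {suc m} v = ∏ (λ q → sg (v zero) (v (suc q))) * E (v ∘ suc)

  E-cong : ∀ {v w : Fin m → Fin n} → (∀ i → v i ≡ w i) → E v ≡ E w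
  E-cong {zero}  eq = refl
  E-cong {suc m} eq =
    cong₂ _*_ (∏-cong (λ q → cong₂ sg (eq zero) (eq (suc q)))) (E-cong (eq ∘ suc))

  Inj : (A → B) → Set
  Inj v = ∀ p q → v p ≡ v q → p ≡ q

  Collision : (Fin m → A) → Set
  Collision v = ∃₂ λ p q → p ≢ q × v p ≡ v q

  inj-or-collision : ∀ (v : Fin m → Fin n) → Inj v ⊎ Collision v
  inj-or-collision {zero} v = inj₁ λ ()
  inj-or-collision {suc m} v with any? (λ q → v zero ≟ v (suc q))
  ... | yes (q , eq) = inj₂ (zero , suc q , (λ ()) , eq)
  ... | no ¬eq with inj-or-collision (v ∘ suc)
  ...   | inj₂ (p , q , p≢q , eq) = inj₂ (suc p , suc q , p≢q ∘ suc-injective , eq)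
  ...   | inj₁ inj = inj₁ λ where
    zero    zero    eq → refl
    zero    (suc q) eq → ⊥-elim (¬eq (q , eq))
    (suc p) zero    eq → ⊥-elim (¬eq (p , sym eq))
    (suc p) (suc q) eq → cong suc (inj p q eq)

  ∏-zero : ∀ (f : Fin m → ℤ) i → f i ≡ 0ℤ → ∏ f ≡ 0ℤ
  ∏-zero f zero    eq = trans (cong₂ _*_ eq refl) (zeroˡ _)
  ∏-zero f (suc i) eq = trans (cong (f zero *_) (∏-zero (f ∘ suc) i eq)) (zeroʳ _)

  sg-zero : ∀ {x y : Fin n} → x ≡ y → sg x y ≡ 0ℤ
  sg-zero {x = x} refl = sg-diag x

  E-collision : ∀ (v : Fin m → Fin n) → Collision v → E v ≡ 0ℤ
  E-collision v (zero , zero , p≢q , eq) = ⊥-elim (p≢q refl)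
  E-collision v (zero , suc q , p≢q , eq) =
    trans (cong₂ _*_ (∏-zero _ q (sg-zero eq)) refl) (zeroˡ _)
  E-collision v (suc p , zero , p≢q , eq) =
    trans (cong₂ _*_ (∏-zero _ p (sg-zero (sym eq))) refl) (zeroˡ _)
  E-collision v (suc p , suc q , p≢q , eq) =
    trans (cong₂ _*_ refl (E-collision (v ∘ suc) (p , q , p≢q ∘ cong suc , eq))) (zeroʳ _)

  E-sq : ∀ (v : Fin m → Fin n) → Inj v → E v * E v ≡ 1ℤ
  E-sq {zero}  v inj = *-identityˡ 1ℤ
  E-sq {suc m} v inj = begin
    E v * E v                        ≡⟨ *-interchange ∏v (E (v ∘ suc)) ∏v _ ⟩
    (∏v * ∏v) * (E (v ∘ suc) * E (v ∘ suc))
      ≡⟨ cong₂ _*_ (trans (sym (∏-* (λ q → sg (v zero) (v (suc q))) _))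
          (∏-one m (λ q → sg-sq _ _ (λ eq → Finₚ.0≢1+n (inj zero (suc q) eq)))))
          (E-sq (v ∘ suc) (λ p q eq → suc-injective (inj _ _ eq))) ⟩
    1ℤ * 1ℤ                          ≡⟨ *-identityˡ 1ℤ ⟩
    1ℤ                               ∎
    where ∏v = ∏ (λ q → sg (v zero) (v (suc q)))

  -- Under the weight `E v` one may argue as if `v` were injective, because the weight vanishes
  -- otherwise. This lets sums over all maps stand in for sums over permutations.
  E-weight : ∀ (v : Fin m → Fin n) {x y} → (Inj v → x ≡ y) → E v * x ≡ E v * y
  E-weight v eq with inj-or-collision v
  ... | inj₁ inj = cong (E v *_) (eq inj)
  ... | inj₂ col = trans (cong₂ _*_ (E-collision v col) refl)
                         (trans (zeroˡ _) (sym (trans (cong₂ _*_ (E-collision v col) refl) (zeroˡ _))))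

  -- The factor `x` if `p < q`, and 1 otherwise. A product over increasing pairs thereby becomes one
  -- over all pairs, which can be reindexed by a permutation.
  up : Fin m → Fin m → ℤ → ℤ
  up zero    zero    x = 1ℤ
  up zero    (suc q) x = x
  up (suc p) zero    x = 1ℤ
  up (suc p) (suc q) x = up p q x

  up-* : ∀ (p q : Fin m) x y → up p q (x * y) ≡ up p q x * up p q y
  up-* zero    zero    x y = sym (*-identityˡ 1ℤ)
  up-* zero    (suc q) x y = refl
  up-* (suc p) zero    x y = sym (*-identityˡ 1ℤ)
  up-* (suc p) (suc q) x y = up-* p q x y

  up-diag : ∀ (p : Fin m) x → up p p x ≡ 1ℤ
  up-diag zero    x = refl
  up-diag (suc p) x = up-diag p x

  up-cong : ∀ (p q : Fin m) {x y} → (p ≢ q → x ≡ y) → up p q x ≡ up p q y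
  up-cong zero    zero    eq = refl
  up-cong zero    (suc q) eq = eq (λ ())
  up-cong (suc p) zero    eq = refl
  up-cong (suc p) (suc q) eq = up-cong p q (λ p≢q → eq (p≢q ∘ suc-injective))

  up-both : ∀ (p q : Fin m) x → p ≢ q → up p q x * up q p (- x) ≡ sg p q * x
  up-both zero    zero    x p≢q = ⊥-elim (p≢q refl)
  up-both zero    (suc q) x p≢q = trans (*-identityʳ x) (sym (*-identityˡ x))
  up-both (suc p) zero    x p≢q = trans (*-identityˡ _) (sym (-1*x≈-x x))
  up-both (suc p) (suc q) x p≢q = up-both p q x (p≢q ∘ cong suc)

  up-split : ∀ (p q : Fin m) x → (p ≡ q → x ≡ 1ℤ) → up p q x * up q p x ≡ x
  up-split zero    zero    x eq = trans (*-identityˡ 1ℤ) (sym (eq refl))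
  up-split zero    (suc q) x eq = *-identityʳ x
  up-split (suc p) zero    x eq = *-identityˡ x
  up-split (suc p) (suc q) x eq = up-split p q x (λ p≡q → eq (cong suc p≡q))

  ∏∏ : (Fin m → Fin n → ℤ) → ℤ
  ∏∏ f = ∏ (λ p → ∏ (λ q → f p q))

  ∏∏-cong : ∀ {f g : Fin m → Fin n → ℤ} → (∀ p q → f p q ≡ g p q) → ∏∏ f ≡ ∏∏ g
  ∏∏-cong eq = ∏-cong (λ p → ∏-cong (eq p))

  ∏∏-* : ∀ (f g : Fin m → Fin n → ℤ) → ∏∏ (λ p q → f p q * g p q) ≡ ∏∏ f * ∏∏ g
  ∏∏-* f g = trans (∏-cong (λ p → ∏-* (f p) (g p))) (∏-* (λ p → ∏ (f p)) _)

  -- The two factors of an unordered pair are collected at its increasing ordering.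
  ∏∏-up : ∀ (f : Fin m → Fin m → ℤ) → (∀ p → f p p ≡ 1ℤ) →
          ∏∏ f ≡ ∏∏ (λ p q → up p q (f p q * f q p))
  ∏∏-up f diag = begin
    ∏∏ f
      ≡⟨ ∏∏-cong (λ p q → sym (up-split p q (f p q) λ { refl → diag p })) ⟩
    ∏∏ (λ p q → up p q (f p q) * up q p (f p q))
      ≡⟨ ∏∏-* _ (λ p q → up q p (f p q)) ⟩
    ∏∏ (λ p q → up p q (f p q)) * ∏∏ (λ p q → up q p (f p q))
      ≡⟨ cong (∏∏ (λ p q → up p q (f p q)) *_) (∏-comm (λ p q → up q p (f p q))) ⟩
    ∏∏ (λ p q → up p q (f p q)) * ∏∏ (λ p q → up p q (f q p))
      ≡⟨ ∏∏-* _ (λ p q → up p q (f q p)) ⟨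
    ∏∏ (λ p q → up p q (f p q) * up p q (f q p))
      ≡⟨ ∏∏-cong (λ p q → sym (up-* p q (f p q) (f q p))) ⟩
    ∏∏ (λ p q → up p q (f p q * f q p)) ∎

  E-∏∏ : ∀ (v : Fin m → Fin n) → E v ≡ ∏∏ (λ p q → up p q (sg (v p) (v q)))
  E-∏∏ {zero}  v = refl
  E-∏∏ {suc m} v = cong₂ _*_ (sym (*-identityˡ _))
    (trans (E-∏∏ (v ∘ suc)) (∏-cong (λ p → sym (*-identityˡ (∏ (λ q → up p q (sg (v (suc p)) (v (suc q)))))))))

  -- If `b` were missed, deleting it from the codomain would inject `n + 1` points into `n`.
  surjective : ∀ (w : Fin n → Fin n) → Inj w → ∀ b → ∃ λ a → w a ≡ b
  surjective {suc n} w inj b with any? (λ a → w a ≟ b)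
  ... | yes hit = hit
  ... | no ¬hit = ⊥-elim (<⇒notInjective {f = λ a → punchOut {i = b} {w a} (λ b≡wa → ¬hit (a , sym b≡wa))}
      (ℕₚ.n<1+n n)
      (λ {p} {q} eq → inj p q (punchOut-injective (λ b≡ → ¬hit (p , sym b≡)) (λ b≡ → ¬hit (q , sym b≡)) eq)))

  perm : ∀ (w : Fin n → Fin n) → Inj w → Permutation n n
  perm w inj = permutation w (proj₁ ∘ surjective w inj)
    (λ b → proj₂ (surjective w inj b))
    (λ a → inj _ _ (proj₂ (surjective w inj (w a))))

  -- Each factor is multiplied by the square of `sg (w p) (w q)`. One copy of this sign produces
  -- `E w`. The other makes the factor symmetric in `p` and `q`, so that it may be attached to the
  -- ordering in which `w p < w q`; reindexing along `w` then gives `E v`.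
  E-∘-inj : ∀ (v : Fin n → Fin k) (w : Fin n → Fin n) → Inj w → E (v ∘ w) ≡ E w * E v
  E-∘-inj v w inj = begin
    E (v ∘ w)
      ≡⟨ E-∏∏ (v ∘ w) ⟩
    ∏∏ (λ p q → up p q (φ p q))
      ≡⟨ ∏∏-cong (λ p q → up-cong p q (λ p≢q → sym (trans (sym (*-assoc (σ p q) (σ p q) _))
           (trans (cong₂ _*_ (sg-sq _ _ (p≢q ∘ inj p q)) refl) (*-identityˡ _))))) ⟩
    ∏∏ (λ p q → up p q (σ p q * (σ p q * φ p q)))
      ≡⟨ ∏∏-cong (λ p q → up-* p q (σ p q) _) ⟩
    ∏∏ (λ p q → up p q (σ p q) * up p q (σ p q * φ p q))
      ≡⟨ ∏∏-* _ (λ p q → up p q (σ p q * φ p q)) ⟩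
    ∏∏ (λ p q → up p q (σ p q)) * ∏∏ (λ p q → up p q (σ p q * φ p q))
      ≡⟨ cong₂ _*_ (sym (E-∏∏ w)) (∏∏-cong (λ p q → up-cong p q (λ p≢q →
           trans (sym (up-both (w p) (w q) (φ p q) (p≢q ∘ inj p q)))
                 (cong (λ x → up (w p) (w q) (φ p q) * up (w q) (w p) x) (sym (sg-anti (v (w q)) _)))))) ⟩
    E w * ∏∏ (λ p q → up p q (up (w p) (w q) (φ p q) * up (w q) (w p) (φ q p)))
      ≡⟨ cong (E w *_) (sym (∏∏-up (λ p q → up (w p) (w q) (φ p q)) (λ p → up-diag (w p) _))) ⟩
    E w * ∏∏ (λ p q → up (w p) (w q) (φ p q))
      ≡⟨ cong (E w *_) (sym (trans (∏-permute (λ p → ∏ (λ q → up p q (sg (v p) (v q)))) (perm w inj))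
           (∏-cong (λ p → ∏-permute (λ q → up (w p) q (sg (v (w p)) (v q))) (perm w inj))))) ⟩
    E w * ∏∏ (λ p q → up p q (sg (v p) (v q)))
      ≡⟨ cong (E w *_) (sym (E-∏∏ v)) ⟩
    E w * E v ∎
    where
    σ = λ p q → sg (w p) (w q)
    φ = λ p q → sg (v (w p)) (v (w q))

  E-∘ : ∀ (v : Fin n → Fin k) (w : Fin n → Fin n) → E (v ∘ w) ≡ E w * E v
  E-∘ v w with inj-or-collision w
  ... | inj₁ inj = E-∘-inj v w inj
  ... | inj₂ (p , q , p≢q , eq) = trans (E-collision (v ∘ w) (p , q , p≢q , cong v eq))
    (sym (trans (cong₂ _*_ (E-collision w (p , q , p≢q , eq)) refl) (zeroˡ _)))

  E-suc : ∀ (v : Fin m → Fin n) → E (λ i → Fin.suc (v i)) ≡ E v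
  E-suc {zero}  v = refl
  E-suc {suc m} v = cong (∏ (λ q → sg (v zero) (v (suc q))) *_) (E-suc (v ∘ suc))

  lift : (Fin m → Fin n) → Fin (suc m) → Fin (suc n)
  lift v = zero F.∷ (suc ∘ v)

  E-lift : ∀ (v : Fin m → Fin n) → E (lift v) ≡ E v
  E-lift {m} v = trans (cong₂ _*_ (∏-one m (λ _ → refl)) (E-suc v)) (*-identityˡ _)

  E-id : ∀ n → E {n} id ≡ 1ℤ
  E-id zero    = refl
  E-id (suc n) = trans (E-cong {n = suc n} {v = id} {w = lift {n = n} id} λ { zero → refl ; (suc _) → refl })
                       (trans (E-lift {n = n} id) (E-id n))

  -- A transposition specified by its values, so that lifts and conjugates of transpositions are
  -- identified with `transpose` through `Swap-unique` and not by computation.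
  Swap : Fin n → Fin n → (Fin n → Fin n) → Set
  Swap p q τ = τ p ≡ q × τ q ≡ p × (∀ r → r ≢ p → r ≢ q → τ r ≡ r)

  Swap-unique : ∀ {p q : Fin n} {τ τ′} → Swap p q τ → Swap p q τ′ → ∀ r → τ r ≡ τ′ r
  Swap-unique {p = p} {q} (τp , τq , τr) (τ′p , τ′q , τ′r) r with r ≟ p | r ≟ q
  ... | yes refl | _        = trans τp (sym τ′p)
  ... | no _     | yes refl = trans τq (sym τ′q)
  ... | no r≢p   | no r≢q   = trans (τr r r≢p r≢q) (sym (τ′r r r≢p r≢q))

  transpose-Swap : ∀ (p q : Fin n) → Swap p q (transpose p q)
  transpose-Swap p q = at-p , at-q , other
    where
    at-p : transpose p q p ≡ q
    at-p with p ≟ p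
    ... | yes _  = refl
    ... | no p≢p = ⊥-elim (p≢p refl)
    at-q : transpose p q q ≡ p
    at-q with q ≟ p
    ... | yes q≡p = q≡p
    ... | no _ with q ≟ q
    ...   | yes _  = refl
    ...   | no q≢q = ⊥-elim (q≢q refl)
    other : ∀ r → r ≢ p → r ≢ q → transpose p q r ≡ r
    other r r≢p r≢q with r ≟ p
    ... | yes r≡p = ⊥-elim (r≢p r≡p)
    ... | no _ with r ≟ q
    ...   | yes r≡q = ⊥-elim (r≢q r≡q)
    ...   | no _    = refl

  lift-Swap : ∀ {p q : Fin n} {τ} → Swap p q τ → Swap (suc p) (suc q) (lift τ)
  lift-Swap (τp , τq , τr) = cong suc τp , cong suc τq , λ where
    zero    _   _   → refl
    (suc r) r≢p r≢q → cong suc (τr r (r≢p ∘ cong suc) (r≢q ∘ cong suc))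

  -- The transposition (0 1) is computed directly. Any further (0 q) is the conjugate by (0 1) of a
  -- lifted transposition, and conjugation leaves the sign unchanged.
  E-swap₀ : ∀ {n} (q : Fin n) τ → Swap zero (suc q) τ → E τ ≡ - 1ℤ
  E-swap₀ {suc n} zero τ sw = begin
    E τ
      ≡⟨ E-cong (Swap-unique sw s₀₁) ⟩
    (- 1ℤ * ∏ {n = n} (λ _ → 1ℤ)) * (∏ {n = n} (λ _ → 1ℤ) * E {n} (λ r → suc (suc r)))
      ≡⟨ cong₂ _*_ (trans (cong (- 1ℤ *_) (∏-one n (λ _ → refl))) (*-identityʳ _))
           (trans (cong₂ _*_ (∏-one n (λ _ → refl))
             (trans (E-suc {n = suc n} suc) (trans (E-suc {n = n} id) (E-id n)))) (*-identityˡ 1ℤ)) ⟩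
    - 1ℤ * 1ℤ
      ≡⟨ *-identityʳ _ ⟩
    - 1ℤ ∎
    where
    s₀₁ : Swap zero (suc zero) (suc zero F.∷ (zero F.∷ (λ r → suc (suc r))))
    s₀₁ = refl , refl , λ where
      zero          0≢0 _   → ⊥-elim (0≢0 refl)
      (suc zero)    _   1≢1 → ⊥-elim (1≢1 refl)
      (suc (suc r)) _   _   → refl
  E-swap₀ {suc n} (suc q) τ sw = begin
    E τ
      ≡⟨ E-cong (Swap-unique sw conjugate) ⟩
    E (t ∘ u ∘ t)
      ≡⟨ E-∘ (t ∘ u) t ⟩
    E t * E (t ∘ u)
      ≡⟨ cong (E t *_) (E-∘ t u) ⟩
    E t * (E u * E t)
      ≡⟨ cong (E t *_) (*-comm (E u) (E t)) ⟩
    E t * (E t * E u)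
      ≡⟨ *-assoc (E t) (E t) (E u) ⟨
    E t * E t * E u
      ≡⟨ cong₂ _*_ (cong₂ _*_ Et Et) (trans (E-lift u′) (E-swap₀ q u′ (transpose-Swap zero (suc q)))) ⟩
    - 1ℤ * - 1ℤ * - 1ℤ
      ≡⟨ cong (_* - 1ℤ) (trans (neg*neg 1ℤ 1ℤ) (*-identityˡ 1ℤ)) ⟩
    1ℤ * - 1ℤ
      ≡⟨ *-identityˡ _ ⟩
    - 1ℤ ∎
    where
    t  = transpose zero (suc zero)
    u′ = transpose zero (suc q)
    u  = lift u′
    Et = E-swap₀ {suc n} zero t (transpose-Swap zero (suc zero))
    u-Swap : Swap (suc zero) (suc (suc q)) u
    u-Swap = lift-Swap (transpose-Swap zero (suc q))
    conjugate : Swap zero (suc (suc q)) (t ∘ u ∘ t)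
    conjugate = cong t (proj₁ u-Swap)
      , cong t (proj₁ (proj₂ u-Swap))
      , λ where
        zero          0≢0 _   → ⊥-elim (0≢0 refl)
        (suc zero)    _   _   → refl
        (suc (suc r)) _   r≢q → cong t (proj₂ (proj₂ u-Swap) (suc (suc r)) (λ ()) r≢q)

  E-swap : ∀ {p q : Fin n} {τ} → p ≢ q → Swap p q τ → E τ ≡ - 1ℤ
  E-swap {p = zero}  {zero}  p≢q sw = ⊥-elim (p≢q refl)
  E-swap {p = zero}  {suc q} p≢q sw = E-swap₀ q _ sw
  E-swap {p = suc p} {zero}  p≢q (τp , τq , τr) = E-swap₀ p _ (τq , τp , λ r r≢q r≢p → τr r r≢p r≢q)
  E-swap {p = suc p} {suc q} p≢q sw = begin
    _                         ≡⟨ E-cong (Swap-unique sw (lift-Swap (transpose-Swap p q))) ⟩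
    E (lift (transpose p q))  ≡⟨ E-lift (transpose p q) ⟩
    E (transpose p q)         ≡⟨ E-swap (p≢q ∘ cong suc) (transpose-Swap p q) ⟩
    - 1ℤ ∎

  E-∘-swap : ∀ (v : Fin n → Fin k) {p q : Fin n} {τ} → p ≢ q → Swap p q τ → E (v ∘ τ) ≡ - E v
  E-∘-swap v {τ = τ} p≢q sw = trans (E-∘ v τ) (trans (cong₂ _*_ (E-swap p≢q sw) refl) (-1*x≈-x _))

  -- Signed sums over maps

  maps : ∀ m k → Enum (Fin m → Fin k)
  maps m k = fun m (fin k)

  ∷-cong : ∀ {x y : A} {v w : Fin m → A} → x ≡ y → (∀ i → v i ≡ w i) → ∀ i → (x F.∷ v) i ≡ (y F.∷ w) i
  ∷-cong p q zero    = p
  ∷-cong p q (suc i) = q i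

  ∑-no-zero : ∀ m (H : (Fin m → Fin (suc k)) → ℤ) → Cong (maps m (suc k)) H →
    (∀ v p → v p ≡ zero → H v ≡ 0ℤ) →
    ∑ (maps m (suc k)) H ≡ ∑ (maps m k) (λ u → H (λ i → suc (u i)))
  ∑-no-zero {k} zero H hc none = trans (∑-fun₀ (fin (suc k)) H) (trans (hc λ ()) (sym (∑-fun₀ (fin k) (λ u → H (λ i → suc (u i))))))
  ∑-no-zero {k} (suc m) H hc none = begin
    ∑ (maps (suc m) (suc k)) H
      ≡⟨ trans (∑-fun (fin (suc k)) H) (∑-fin k _) ⟩
    ∑ (maps m (suc k)) (λ v → H (zero F.∷ v)) + ∑ (fin k) (λ y → ∑ (maps m (suc k)) (λ v → H (suc y F.∷ v)))
      ≡⟨ cong₂ _+_ (∑-zero (maps m (suc k)) (λ v → none _ zero refl))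
           (∑-cong (fin k) (λ y → ∑-no-zero m (λ v → H (suc y F.∷ v))
              (λ eq → hc (∷-cong refl eq)) (λ v p eq → none _ (suc p) eq))) ⟩
    0ℤ + ∑ (fin k) (λ y → ∑ (maps m k) (λ u → H (suc y F.∷ (λ i → suc (u i)))))
      ≡⟨ +-identityˡ _ ⟩
    ∑ (fin k) (λ y → ∑ (maps m k) (λ u → H (suc y F.∷ (λ i → suc (u i)))))
      ≡⟨ ∑-cong (fin k) (λ y → ∑-cong (maps m k) (λ u → hc (λ { zero → refl ; (suc i) → refl }))) ⟩
    ∑ (fin k) (λ y → ∑ (maps m k) (λ u → H (λ i → suc ((y F.∷ u) i))))
      ≡⟨ ∑-fun (fin k) _ ⟨
    ∑ (maps (suc m) k) (λ u → H (λ i → suc (u i))) ∎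

  insert₀ : (Fin m → Fin k) → Fin (suc m) → Fin (suc m) → Fin (suc k)
  insert₀ u c = F.insertAt (λ i → suc (u i)) c zero

  insertAt-cong : ∀ {u v : Fin m → A} c x → (∀ i → u i ≡ v i) → ∀ i → F.insertAt u c x i ≡ F.insertAt v c x i
  insertAt-cong {m = m}     zero    x eq zero    = refl
  insertAt-cong {m = m}     zero    x eq (suc i) = eq i
  insertAt-cong {m = suc m} (suc c) x eq zero    = eq zero
  insertAt-cong {m = suc m} (suc c) x eq (suc i) = insertAt-cong c x (eq ∘ suc) i

  -- The surviving maps take the value 0 at a single place `c`, and are determined by `c` and the
  -- remaining letters. On summands weighted by a sign this is the expansion along the value 0.
  ∑-one-zero : ∀ m (H : (Fin (suc m) → Fin (suc k)) → ℤ) → Cong (maps (suc m) (suc k)) H →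
    (∀ v → (∀ p → v p ≢ zero) → H v ≡ 0ℤ) →
    (∀ v p q → p ≢ q → v p ≡ zero → v q ≡ zero → H v ≡ 0ℤ) →
    ∑ (maps (suc m) (suc k)) H ≡ ∑ (fin (suc m)) (λ c → ∑ (maps m k) (λ u → H (insert₀ u c)))
  ∑-one-zero {k} m H hc none two = begin
    ∑ (maps (suc m) (suc k)) H
      ≡⟨ trans (∑-fun (fin (suc k)) H) (∑-fin k _) ⟩
    ∑ (maps m (suc k)) (λ v → H (zero F.∷ v)) + ∑ (fin k) (λ y → ∑ (maps m (suc k)) (λ v → H (suc y F.∷ v)))
      ≡⟨ cong₂ _+_ first (rest m H hc none two) ⟩
    ∑ (maps m k) (λ u → H (insert₀ u zero)) + ∑ (fin m) (λ c → ∑ (maps m k) (λ u → H (insert₀ u (suc c))))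
      ≡⟨ ∑-fin m _ ⟨
    ∑ (fin (suc m)) (λ c → ∑ (maps m k) (λ u → H (insert₀ u c))) ∎
    where
    first : ∑ (maps m (suc k)) (λ v → H (zero F.∷ v)) ≡ ∑ (maps m k) (λ u → H (insert₀ u zero))
    first = trans (∑-no-zero m (λ v → H (zero F.∷ v)) (λ eq → hc (∷-cong refl eq))
                     (λ v p eq → two _ zero (suc p) (λ ()) refl eq))
                  (∑-cong (maps m k) (λ u → hc λ { zero → refl ; (suc i) → refl }))
    rest : ∀ m (H : (Fin (suc m) → Fin (suc k)) → ℤ) → Cong (maps (suc m) (suc k)) H →
      (∀ v → (∀ p → v p ≢ zero) → H v ≡ 0ℤ) →
      (∀ v p q → p ≢ q → v p ≡ zero → v q ≡ zero → H v ≡ 0ℤ) →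
      ∑ (fin k) (λ y → ∑ (maps m (suc k)) (λ v → H (suc y F.∷ v)))
      ≡ ∑ (fin m) (λ c → ∑ (maps m k) (λ u → H (insert₀ u (suc c))))
    rest zero H hc none two = trans
      (∑-zero (fin k) (λ y → trans (∑-fun₀ (fin (suc k)) _) (none _ λ { zero () })))
      (sym (∑-fin₀ _))
    rest (suc m) H hc none two = begin
      ∑ (fin k) (λ y → ∑ (maps (suc m) (suc k)) (λ v → H (suc y F.∷ v)))
        ≡⟨ ∑-cong (fin k) (λ y → ∑-one-zero m (λ v → H (suc y F.∷ v)) (λ eq → hc (∷-cong refl eq))
             (λ v nz → none _ λ { (suc p) eq → nz p eq })
             (λ v p q p≢q vp vq → two _ (suc p) (suc q) (p≢q ∘ suc-injective) vp vq)) ⟩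
      ∑ (fin k) (λ y → ∑ (fin (suc m)) (λ c → ∑ (maps m k) (λ u → H (suc y F.∷ insert₀ u c))))
        ≡⟨ ∑-comm (fin k) (fin (suc m)) _ ⟩
      ∑ (fin (suc m)) (λ c → ∑ (fin k) (λ y → ∑ (maps m k) (λ u → H (suc y F.∷ insert₀ u c))))
        ≡⟨ ∑-cong (fin (suc m)) (λ c → ∑-cong (fin k) (λ y → ∑-cong (maps m k) (λ u →
             hc λ { zero → refl ; (suc i) → insertAt-cong c zero (λ _ → refl) i }))) ⟩
      ∑ (fin (suc m)) (λ c → ∑ (fin k) (λ y → ∑ (maps m k) (λ u → H (insert₀ (y F.∷ u) (suc c)))))
        ≡⟨ ∑-cong (fin (suc m)) (λ c → sym (∑-fun (fin k) (λ u → H (insert₀ u (suc c))))) ⟩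
      ∑ (fin (suc m)) (λ c → ∑ (maps (suc m) k) (λ u → H (insert₀ u (suc c)))) ∎

  ∑-insertAt : ∀ (a : Fin (suc m)) (G : (Fin (suc m) → Fin k) → ℤ) → Cong (maps (suc m) k) G →
    ∑ (maps (suc m) k) G ≡ ∑ (fin k) (λ y → ∑ (maps m k) (λ w → G (F.insertAt w a y)))
  ∑-insertAt {m} {k} zero G gc = trans (∑-fun (fin k) G)
    (∑-cong (fin k) (λ y → ∑-cong (maps m k) (λ w → gc λ { zero → refl ; (suc i) → refl })))
  ∑-insertAt {suc m} {k} (suc a) G gc = begin
    ∑ (maps (suc (suc m)) k) G
      ≡⟨ ∑-fun (fin k) G ⟩
    ∑ (fin k) (λ x → ∑ (maps (suc m) k) (λ v → G (x F.∷ v)))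
      ≡⟨ ∑-cong (fin k) (λ x → ∑-insertAt a (λ v → G (x F.∷ v)) (λ eq → gc (∷-cong refl eq))) ⟩
    ∑ (fin k) (λ x → ∑ (fin k) (λ y → ∑ (maps m k) (λ w → G (x F.∷ F.insertAt w a y))))
      ≡⟨ ∑-comm (fin k) (fin k) _ ⟩
    ∑ (fin k) (λ y → ∑ (fin k) (λ x → ∑ (maps m k) (λ w → G (x F.∷ F.insertAt w a y))))
      ≡⟨ ∑-cong (fin k) (λ y → ∑-cong (fin k) (λ x → ∑-cong (maps m k) (λ w →
           gc λ { zero → refl ; (suc i) → insertAt-cong a y (λ _ → refl) i }))) ⟩
    ∑ (fin k) (λ y → ∑ (fin k) (λ x → ∑ (maps m k) (λ w → G (F.insertAt (x F.∷ w) (suc a) y))))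
      ≡⟨ ∑-cong (fin k) (λ y → sym (∑-fun (fin k) (λ w → G (F.insertAt w (suc a) y)))) ⟩
    ∑ (fin k) (λ y → ∑ (maps (suc m) k) (λ w → G (F.insertAt w (suc a) y))) ∎

  infixl 20 _[_≔_]
  _[_≔_] : (Fin m → A) → Fin m → A → Fin m → A
  v [ a ≔ x ] = F.updateAt v a (λ _ → x)

  ≔-hit : ∀ (v : Fin m → A) a x → (v [ a ≔ x ]) a ≡ x
  ≔-hit v a x = updateAt-updates a v

  ≔-miss : ∀ (v : Fin m → A) {a b} x → b ≢ a → (v [ a ≔ x ]) b ≡ v b
  ≔-miss v {a} {b} x b≢a = updateAt-minimal b a v b≢a

  ≔-unique : ∀ (v w : Fin m → A) a x → w a ≡ x → (∀ b → b ≢ a → w b ≡ v b) → ∀ b → (v [ a ≔ x ]) b ≡ w b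
  ≔-unique v w a x hit miss b with b ≟ a
  ... | yes refl = trans (≔-hit v a x) (sym hit)
  ... | no b≢a   = trans (≔-miss v x b≢a) (sym (miss b b≢a))

  ≔-cong : ∀ {v w : Fin m → A} a {x y} → (∀ b → v b ≡ w b) → x ≡ y → ∀ b → (v [ a ≔ x ]) b ≡ (w [ a ≔ y ]) b
  ≔-cong {v = v} {w} a {x} {y} eq refl = ≔-unique v (w [ a ≔ y ]) a x (≔-hit w a y)
    (λ b b≢a → trans (≔-miss w y b≢a) (sym (eq b)))

  -- w = v[a≔j] with v a = i if and only if v = w[a≔i] with w a = j.
  ∑-replace : ∀ (a : Fin m) (i j : Fin k) (H : (v w : Fin m → Fin k) → ℤ) →
    (∀ {v v′ w w′} → (∀ b → v b ≡ v′ b) → (∀ b → w b ≡ w′ b) → H v w ≡ H v′ w′) →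
    ∑ (maps m k) (λ v → ⟦ v a ≟ i ⟧ * H v (v [ a ≔ j ])) ≡ ∑ (maps m k) (λ w → ⟦ w a ≟ j ⟧ * H (w [ a ≔ i ]) w)
  ∑-replace {suc m} {k} zero i j H hc = begin
    ∑ (maps (suc m) k) (λ v → ⟦ v zero ≟ i ⟧ * H v (v [ zero ≔ j ]))
      ≡⟨ collapse i (λ v → H v (v [ zero ≔ j ])) (λ eq → hc eq (≔-cong zero eq refl)) ⟩
    ∑ (maps m k) (λ v → H (i F.∷ v) ((i F.∷ v) [ zero ≔ j ]))
      ≡⟨ ∑-cong (maps m k) (λ v → hc (λ { zero → refl ; (suc _) → refl }) (λ { zero → refl ; (suc _) → refl })) ⟩
    ∑ (maps m k) (λ v → H ((j F.∷ v) [ zero ≔ i ]) (j F.∷ v))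
      ≡⟨ collapse j (λ w → H (w [ zero ≔ i ]) w) (λ eq → hc (≔-cong zero eq refl) eq) ⟨
    ∑ (maps (suc m) k) (λ w → ⟦ w zero ≟ j ⟧ * H (w [ zero ≔ i ]) w) ∎
    where
    collapse : ∀ i (G : (Fin (suc m) → Fin k) → ℤ) → Cong (maps (suc m) k) G →
      ∑ (maps (suc m) k) (λ v → ⟦ v zero ≟ i ⟧ * G v) ≡ ∑ (maps m k) (λ v → G (i F.∷ v))
    collapse i G gc = trans (∑-fun (fin k) _)
      (trans (∑-cong (fin k) (λ x → ∑-*ˡ (maps m k) ⟦ x ≟ i ⟧ (λ v → G (x F.∷ v))))
             (∑-fin-pick k (λ x → ∑ (maps m k) (λ v → G (x F.∷ v))) i))
  ∑-replace {suc m} {k} (suc a) i j H hc = begin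
    ∑ (maps (suc m) k) (λ v → ⟦ v (suc a) ≟ i ⟧ * H v (v [ suc a ≔ j ]))
      ≡⟨ ∑-fun (fin k) _ ⟩
    ∑ (fin k) (λ x → ∑ (maps m k) (λ v → ⟦ v a ≟ i ⟧ * H (x F.∷ v) ((x F.∷ v) [ suc a ≔ j ])))
      ≡⟨ ∑-cong (fin k) (λ x → trans
           (∑-cong (maps m k) (λ v → cong (⟦ v a ≟ i ⟧ *_) (hc (λ _ → refl) (λ { zero → refl ; (suc _) → refl }))))
           (trans (∑-replace a i j (λ v w → H (x F.∷ v) (x F.∷ w)) (λ p q → hc (∷-cong refl p) (∷-cong refl q)))
           (∑-cong (maps m k) (λ v → cong (⟦ v a ≟ j ⟧ *_) (hc (λ { zero → refl ; (suc _) → refl }) (λ _ → refl)))))) ⟩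
    ∑ (fin k) (λ x → ∑ (maps m k) (λ w → ⟦ w a ≟ j ⟧ * H ((x F.∷ w) [ suc a ≔ i ]) (x F.∷ w)))
      ≡⟨ ∑-fun (fin k) _ ⟨
    ∑ (maps (suc m) k) (λ w → ⟦ w (suc a) ≟ j ⟧ * H (w [ suc a ≔ i ]) w) ∎

  ∑-const : ∀ k c → ∑ (fin k) (λ _ → c) ≡ ι k * c
  ∑-const zero    c = trans (∑-fin₀ _) (sym (trans (cong (_* c) ι-0) (zeroˡ c)))
  ∑-const (suc k) c = begin
    ∑ (fin (suc k)) (λ _ → c)        ≡⟨ ∑-fin k _ ⟩
    c + ∑ (fin k) (λ _ → c)          ≡⟨ cong₂ _+_ (sym (trans (cong (_* c) ι-1) (*-identityˡ c))) (∑-const k c) ⟩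
    ι 1 * c + ι k * c                ≡⟨ distribʳ c (ι 1) (ι k) ⟨
    (ι 1 + ι k) * c                  ≡⟨ cong (_* c) (sym (ι-+ 1 k)) ⟩
    ι (suc k) * c                    ∎

  -- Overwriting the letter at `a` forgets it, so every map is reached once for each of the `k`
  -- possible old letters.
  ∑-update : ∀ (a : Fin m) (g : (Fin m → Fin k) → ℤ) → Cong (maps m k) g →
    ∑ (maps m k) (λ v → ∑ (fin k) (λ x → g (v [ a ≔ x ]))) ≡ ι k * ∑ (maps m k) g
  ∑-update {suc m} {k} zero g gc = begin
    ∑ (maps (suc m) k) (λ v → ∑ (fin k) (λ x → g (v [ zero ≔ x ])))
      ≡⟨ ∑-fun (fin k) _ ⟩
    ∑ (fin k) (λ y → ∑ (maps m k) (λ v → ∑ (fin k) (λ x → g ((y F.∷ v) [ zero ≔ x ]))))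
      ≡⟨ ∑-cong (fin k) (λ y → trans (∑-cong (maps m k) (λ v → ∑-cong (fin k) (λ x →
            gc (λ { zero → refl ; (suc _) → refl })))) (∑-comm (maps m k) (fin k) _)) ⟩
    ∑ (fin k) (λ y → ∑ (fin k) (λ x → ∑ (maps m k) (λ v → g (x F.∷ v))))
      ≡⟨ ∑-cong (fin k) (λ y → sym (∑-fun (fin k) g)) ⟩
    ∑ (fin k) (λ y → ∑ (maps (suc m) k) g)
      ≡⟨ ∑-const k _ ⟩
    ι k * ∑ (maps (suc m) k) g ∎
  ∑-update {suc m} {k} (suc a) g gc = begin
    ∑ (maps (suc m) k) (λ v → ∑ (fin k) (λ x → g (v [ suc a ≔ x ])))
      ≡⟨ ∑-fun (fin k) _ ⟩
    ∑ (fin k) (λ y → ∑ (maps m k) (λ v → ∑ (fin k) (λ x → g ((y F.∷ v) [ suc a ≔ x ]))))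
      ≡⟨ ∑-cong (fin k) (λ y → trans (∑-cong (maps m k) (λ v → ∑-cong (fin k) (λ x →
            gc (λ { zero → refl ; (suc _) → refl })))) (∑-update a (λ v → g (y F.∷ v)) (λ eq → gc (∷-cong refl eq)))) ⟩
    ∑ (fin k) (λ y → ι k * ∑ (maps m k) (λ v → g (y F.∷ v)))
      ≡⟨ ∑-*ˡ (fin k) (ι k) (λ y → ∑ (maps m k) (λ v → g (y F.∷ v))) ⟩
    ι k * ∑ (fin k) (λ y → ∑ (maps m k) (λ v → g (y F.∷ v)))
      ≡⟨ cong (ι k *_) (sym (∑-fun (fin k) g)) ⟩
    ι k * ∑ (maps (suc m) k) g ∎

  sq : (Fin m → Fin n) → ℤ
  sq v = E v * E v

  -- The inserted 0 forms an inversion with each earlier place and with no later one; the resulting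
  -- power of -1 disappears in the square.
  E-insert₀-sq : ∀ (u : Fin m → Fin k) c → sq (insert₀ u c) ≡ sq u
  E-insert₀-sq {m} u zero = cong₂ _*_ eq eq
    where
    eq = trans (E-cong {v = insert₀ u zero} {lift u} (λ { zero → refl ; (suc i) → refl })) (E-lift u)
  E-insert₀-sq {suc m} {k} u (suc c) = begin
    (∏f * E (insert₀ (u ∘ suc) c)) * (∏f * E (insert₀ (u ∘ suc) c))
      ≡⟨ *-interchange ∏f _ ∏f _ ⟩
    (∏f * ∏f) * sq (insert₀ (u ∘ suc) c)
      ≡⟨ cong₂ _*_ (trans (cong₂ _*_ ∏f-eq ∏f-eq) (neg*neg _ _)) (E-insert₀-sq (u ∘ suc) c) ⟩
    (∏g * ∏g) * sq (u ∘ suc)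
      ≡⟨ *-interchange ∏g _ (E (u ∘ suc)) _ ⟩
    sq u ∎
    where
    f : Fin (suc m) → ℤ
    f q = sg (suc (u zero)) (insert₀ (u ∘ suc) c q)
    ∏f = ∏ f
    ∏g = ∏ (λ q → sg (u zero) (u (suc q)))
    ∏f-eq : ∏f ≡ - ∏g
    ∏f-eq = trans (∏-remove {i = c} f) (trans (cong₂ _*_
      (cong (sg (suc (u zero))) (insertAt-lookup (λ i → suc (u (suc i))) c zero))
      (∏-cong (λ q → cong (sg (suc (u zero))) (insertAt-punchIn (λ i → suc (u (suc i))) c zero q))))
      (-1*x≈-x _))

  -- Without the value 0 only `m` values remain for `m + 1` places, so two places collide.
  E-no-zero : ∀ (v : Fin (suc m) → Fin (suc m)) → (∀ p → v p ≢ zero) → E v ≡ 0ℤ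
  E-no-zero {m} v nz
    with p , q , p<q , eq ← pigeonhole (ℕₚ.n<1+n m) (λ p → punchOut {i = zero} (λ 0≡vp → nz p (sym 0≡vp)))
    = E-collision v (p , q , Finₚ.<⇒≢ p<q , punchOut-injective {i = zero} _ _ eq)

  zero* : ∀ {x y : ℤ} → x ≡ 0ℤ → x * y ≡ 0ℤ
  zero* eq = trans (cong₂ _*_ eq refl) (zeroˡ _)

  ∑-sq-insert : ∀ m (g : (Fin (suc m) → Fin (suc m)) → ℤ) → Cong (maps (suc m) (suc m)) g →
    ∑ (maps (suc m) (suc m)) (λ v → sq v * g v) ≡
    ∑ (fin (suc m)) (λ c → ∑ (maps m m) (λ u → sq u * g (insert₀ u c)))
  ∑-sq-insert m g gc = trans
    (∑-one-zero m (λ v → sq v * g v) (λ eq → cong₂ _*_ (cong₂ _*_ (E-cong eq) (E-cong eq)) (gc eq))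
       (λ v nz → zero* (zero* (E-no-zero v nz)))
       (λ v p q p≢q vp vq → zero* (zero* (E-collision v (p , q , p≢q , trans vp (sym vq))))))
    (∑-cong (fin (suc m)) (λ c → ∑-cong (maps m m) (λ u → cong (_* g (insert₀ u c)) (E-insert₀-sq u c))))

  -- The permutations of 0, …, m are those fixing 0, and these composed with a
  -- transposition (0 a).
  ∑-E-transpose : ∀ m (g : (Fin (suc m) → Fin (suc m)) → ℤ) → Cong (maps (suc m) (suc m)) g →
    ∑ (maps (suc m) (suc m)) (λ v → E v * g v) ≡
    ∑ (maps m m) (λ u → E u * (g (lift u) + - ∑ (fin m) (λ a → g (lift u ∘ transpose zero (suc a)))))
  ∑-E-transpose m g gc = begin
    ∑ (maps (suc m) (suc m)) H
      ≡⟨ ∑-one-zero m H hc (λ v nz → zero* (E-no-zero v nz))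
          (λ v p q p≢q vp vq → zero* (E-collision v (p , q , p≢q , trans vp (sym vq)))) ⟩
    ∑ (fin (suc m)) (λ c → ∑ (maps m m) (λ u → H (insert₀ u c)))
      ≡⟨ ∑-fin m _ ⟩
    ∑ (maps m m) (λ u → H (insert₀ u zero)) + ∑ (fin m) (λ a → ∑ (maps m m) (λ u → H (insert₀ u (suc a))))
      ≡⟨ cong₂ _+_ (∑-cong (maps m m) (λ u → trans (hc λ { zero → refl ; (suc i) → refl })
                                           (cong (_* g (lift u)) (E-lift u))))
                   (∑-cong (fin m) (λ a → trans (rotate m a H hc) (∑-cong (maps m m) (λ u →
                     cong (_* g (lift u ∘ transpose zero (suc a)))
                       (trans (E-∘-swap (lift u) (λ ()) (transpose-Swap zero (suc a))) (cong -_ (E-lift u))))))) ⟩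
    ∑ (maps m m) (λ u → E u * g (lift u)) + ∑ (fin m) (λ a → ∑ (maps m m) (λ u → - E u * gt u a))
      ≡⟨ cong (∑ (maps m m) (λ u → E u * g (lift u)) +_) (∑-comm (fin m) (maps m m) _) ⟩
    ∑ (maps m m) (λ u → E u * g (lift u)) + ∑ (maps m m) (λ u → ∑ (fin m) (λ a → - E u * gt u a))
      ≡⟨ ∑-+ (maps m m) _ _ ⟨
    ∑ (maps m m) (λ u → E u * g (lift u) + ∑ (fin m) (λ a → - E u * gt u a))
      ≡⟨ ∑-cong (maps m m) (λ u → trans (cong (E u * g (lift u) +_)
           (trans (∑-*ˡ (fin m) (- E u) (gt u)) (trans (sym (-‿distribˡ-* (E u) _)) (-‿distribʳ-* (E u) _))))
           (sym (distribˡ (E u) _ _))) ⟩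
    ∑ (maps m m) (λ u → E u * (g (lift u) + - ∑ (fin m) (gt u))) ∎
    where
    H : (Fin (suc m) → Fin (suc m)) → ℤ
    H v = E v * g v
    hc : Cong (maps (suc m) (suc m)) H
    hc eq = cong₂ _*_ (E-cong eq) (gc eq)
    gt : (Fin m → Fin m) → Fin m → ℤ
    gt u a = g (lift u ∘ transpose zero (suc a))
    -- Insertion keeps the order of the other letters, whereas the transposition exchanges the first
    -- letter with the 0. The two differ by moving one letter of `u` from the front to place `a`,
    -- which a sum over all `u` does not see.
    rotate : ∀ m (a : Fin m) (H : (Fin (suc m) → Fin (suc m)) → ℤ) → Cong (maps (suc m) (suc m)) H →
      ∑ (maps m m) (λ u → H (insert₀ u (suc a))) ≡ ∑ (maps m m) (λ u → H (lift u ∘ transpose zero (suc a)))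
    rotate (suc m) a H hc = begin
      ∑ (maps (suc m) (suc m)) (λ u → H (insert₀ u (suc a)))
        ≡⟨ ∑-fun (fin (suc m)) _ ⟩
      ∑ (fin (suc m)) (λ y → ∑ (maps m (suc m)) (λ w → H (insert₀ (y F.∷ w) (suc a))))
        ≡⟨ ∑-cong (fin (suc m)) (λ y → ∑-cong (maps m (suc m)) (λ w → hc (λ r → sym (same y w r)))) ⟩
      ∑ (fin (suc m)) (λ y → ∑ (maps m (suc m)) (λ w → H (lift (F.insertAt w a y) ∘ transpose zero (suc a))))
        ≡⟨ ∑-insertAt a (λ u → H (lift u ∘ transpose zero (suc a)))
             (λ eq → hc (λ r → lift-cong eq (transpose zero (suc a) r))) ⟨
      ∑ (maps (suc m) (suc m)) (λ u → H (lift u ∘ transpose zero (suc a))) ∎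
      where
      lift-cong : ∀ {u u′ : Fin (suc m) → Fin (suc m)} → (∀ i → u i ≡ u′ i) → ∀ r → lift u r ≡ lift u′ r
      lift-cong eq zero    = refl
      lift-cong eq (suc r) = cong suc (eq r)
      same : ∀ y w r → lift (F.insertAt w a y) (transpose zero (suc a) r) ≡ insert₀ (y F.∷ w) (suc a) r
      same y w zero = trans (cong (lift (F.insertAt w a y)) (proj₁ (transpose-Swap zero (suc a))))
                            (cong suc (insertAt-lookup w a y))
      same y w (suc r) = at (r ≟ a)
        where
        insert-suc : ∀ {m k} (w : Fin m → Fin k) a y r → r ≢ a →
          Fin.suc (F.insertAt w a y r) ≡ F.insertAt (λ i → Fin.suc (w i)) a zero r
        insert-suc         w zero    y zero    r≢a = ⊥-elim (r≢a refl)
        insert-suc         w zero    y (suc r) r≢a = refl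
        insert-suc {suc m} w (suc a) y zero    r≢a = refl
        insert-suc {suc m} w (suc a) y (suc r) r≢a = insert-suc (w ∘ suc) a y r (r≢a ∘ cong suc)
        at : Dec (r ≡ a) → lift (F.insertAt w a y) (transpose zero (suc a) (suc r)) ≡ insert₀ (y F.∷ w) (suc a) (suc r)
        at (yes refl) = trans (cong (lift (F.insertAt w a y)) (proj₁ (proj₂ (transpose-Swap zero (suc a)))))
                              (sym (insertAt-lookup (λ i → suc (w i)) a zero))
        at (no r≢a) = trans (cong (lift (F.insertAt w a y))
                               (proj₂ (proj₂ (transpose-Swap zero (suc a))) (suc r) (λ ()) (r≢a ∘ suc-injective)))
                            (insert-suc w a y r r≢a)

  -- Polarization and the rising factorial

  -- A bijection takes the value `i` exactly once, and all other maps have `E w = 0`.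
  E-count : ∀ (w : Fin n → Fin n) i → E w * ∑ (fin n) (λ a → ⟦ w a ≟ i ⟧ * 1ℤ) ≡ E w
  E-count {n} w i = trans (E-weight w count) (*-identityʳ _)
    where
    count : Inj w → ∑ (fin n) (λ a → ⟦ w a ≟ i ⟧ * 1ℤ) ≡ 1ℤ
    count inj with b , wb ← surjective w inj i = trans
      (∑-cong (fin n) (λ a → ⟦⟧-cong (w a ≟ i) (a ≟ b)
        (λ wa → inj a b (trans wa (sym wb))) (λ { refl → wb }) (λ _ → refl)))
      (∑-fin-pick n (λ _ → 1ℤ) b)

  -- The double sum over the pairs of places of v holding i is antisymmetric.
  E-polarize : ∀ {i j} (v : Fin n → Fin n) → i ≢ j →
               ∑ (fin n) (λ a → ⟦ v a ≟ i ⟧ * E (v [ a ≔ j ])) ≡ 0ℤ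
  E-polarize {n} {i} {j} v i≢j = trans (sym ∑∑D) (self-neg⇒0 _ (begin
    ∑ (fin n) (λ a → ∑ (fin n) (λ b → D a b))
      ≡⟨ ∑-comm (fin n) (fin n) D ⟩
    ∑ (fin n) (λ b → ∑ (fin n) (λ a → D a b))
      ≡⟨ ∑-cong (fin n) (λ b → trans (∑-cong (fin n) (λ a → D-anti a b)) (∑-neg (fin n) (D b))) ⟩
    ∑ (fin n) (λ b → - ∑ (fin n) (λ a → D b a))
      ≡⟨ ∑-neg (fin n) (λ b → ∑ (fin n) (D b)) ⟩
    - ∑ (fin n) (λ a → ∑ (fin n) (λ b → D a b)) ∎))
    where
    D : Fin n → Fin n → ℤ
    D a b = ⟦ v a ≟ i ⟧ * (⟦ (v [ a ≔ j ]) b ≟ i ⟧ * E (v [ a ≔ j ]))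
    -- By `E-count` the extra sum over `b` is free: once `a` holds `j`, a nonzero sign leaves
    -- exactly one place holding `i`.
    ∑∑D : ∑ (fin n) (λ a → ∑ (fin n) (λ b → D a b)) ≡ ∑ (fin n) (λ a → ⟦ v a ≟ i ⟧ * E (v [ a ≔ j ]))
    ∑∑D = ∑-cong (fin n) (λ a → trans (∑-*ˡ (fin n) _ _) (cong (⟦ v a ≟ i ⟧ *_)
      (trans (∑-cong (fin n) (λ b → trans (*-comm _ _) (cong (E (v [ a ≔ j ]) *_) (sym (*-identityʳ _)))))
        (trans (∑-*ˡ (fin n) (E (v [ a ≔ j ])) _) (E-count (v [ a ≔ j ]) i)))))
    D-diag : ∀ a → D a a ≡ 0ℤ
    D-diag a = trans (cong (⟦ v a ≟ i ⟧ *_) (⟦⟧-no ((v [ a ≔ j ]) a ≟ i) (λ eq → i≢j (trans (sym eq) (≔-hit v a j))))) (zeroʳ _)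
    D-no : ∀ a b → a ≢ b → v b ≢ i → D a b ≡ 0ℤ
    D-no a b a≢b vb = trans (cong (⟦ v a ≟ i ⟧ *_) (⟦⟧-no ((v [ a ≔ j ]) b ≟ i)
      (λ eq → vb (trans (sym (≔-miss v j (a≢b ∘ sym))) eq)))) (zeroʳ _)
    0≡-0 : 0ℤ ≡ - 0ℤ
    0≡-0 = sym -0#≈0#
    D-yes : ∀ a b → a ≢ b → v a ≡ i → v b ≡ i → D a b ≡ E (v [ a ≔ j ])
    D-yes a b a≢b va vb = trans (⟦⟧-yes (v a ≟ i) va)
      (⟦⟧-yes ((v [ a ≔ j ]) b ≟ i) (trans (≔-miss v j (a≢b ∘ sym)) vb))
    -- Since `v` takes the same value at `a` and `b`, overwriting one place or the other gives maps
    -- that differ by the transposition of the two places.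
    D-swap : ∀ a b → a ≢ b → v a ≡ i → v b ≡ i → E (v [ a ≔ j ]) ≡ - E (v [ b ≔ j ])
    D-swap a b a≢b va vb = trans
      (E-cong (≔-unique v (v [ b ≔ j ] ∘ τ) a j (trans (cong (v [ b ≔ j ]) τa) (≔-hit v b j)) other))
      (E-∘-swap (v [ b ≔ j ]) a≢b (transpose-Swap a b))
      where
      τ  = transpose a b
      τa = proj₁ (transpose-Swap a b)
      τb = proj₁ (proj₂ (transpose-Swap a b))
      other : ∀ c → c ≢ a → (v [ b ≔ j ]) (τ c) ≡ v c
      other c c≢a = at (c ≟ b)
        where
        at : Dec (c ≡ b) → (v [ b ≔ j ]) (τ c) ≡ v c
        at (yes refl) = trans (cong (v [ b ≔ j ]) τb) (trans (≔-miss v j a≢b) (trans va (sym vb)))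
        at (no c≢b) = trans (cong (v [ b ≔ j ]) (proj₂ (proj₂ (transpose-Swap a b)) c c≢a c≢b)) (≔-miss v j c≢b)
    D-anti : ∀ a b → D a b ≡ - D b a
    D-anti a b = cases (a ≟ b) (v a ≟ i) (v b ≟ i)
      where
      cases : Dec (a ≡ b) → Dec (v a ≡ i) → Dec (v b ≡ i) → D a b ≡ - D b a
      cases (yes refl) _ _ = trans (D-diag a) (trans 0≡-0 (cong -_ (sym (D-diag a))))
      cases (no a≢b) (no va) _ = trans (⟦⟧-no (v a ≟ i) va)
        (trans 0≡-0 (cong -_ (sym (D-no b a (a≢b ∘ sym) va))))
      cases (no a≢b) (yes va) (no vb) = trans (D-no a b a≢b vb)
        (trans 0≡-0 (cong -_ (sym (⟦⟧-no (v b ≟ i) vb))))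
      cases (no a≢b) (yes va) (yes vb) = trans (D-yes a b a≢b va vb)
        (trans (D-swap a b a≢b va vb) (cong -_ (sym (D-yes b a (a≢b ∘ sym) vb va))))

  -- The product q (q + 1) ... (q + n - 1), which is the sum over the permutations of `n` points of
  -- `q` to the number of cycles.
  rising : ℕ → ℕ → ℕ
  rising q zero    = 1
  rising q (suc n) = (q ℕ.+ n) ℕ.* rising q n

  lift-cong : ∀ {u v : Fin m → Fin k} → (∀ i → u i ≡ v i) → ∀ i → lift u i ≡ lift v i
  lift-cong eq zero    = refl
  lift-cong eq (suc i) = cong suc (eq i)

  lift-transpose : ∀ (u : Fin m → Fin k) e b r →
                   lift (u ∘ transpose e b) r ≡ lift u (transpose (suc e) (suc b) r)
  lift-transpose u e b r = trans (lift-∘ r)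
    (cong (lift u) (Swap-unique (lift-Swap (transpose-Swap e b)) (transpose-Swap (suc e) (suc b)) r))
    where
    lift-∘ : ∀ r → lift (u ∘ transpose e b) r ≡ lift u (lift (transpose e b) r)
    lift-∘ zero    = refl
    lift-∘ (suc r) = refl

  *-swap : ∀ a b c → a * (b * c) ≡ b * (a * c)
  *-swap a b c = trans (sym (*-assoc a b c)) (trans (cong (_* c) (*-comm a b)) (*-assoc b a c))

  -- If composing with a transposition that moves a fixed point multiplies S by
  -- -1/q, then S t depends only on the number of cycles of t, and the signed sum
  -- of S is a rising factorial.
  signed-cycle-sum : ∀ q n (S : (Fin n → Fin n) → ℤ) → Cong (maps n n) S →
    (∀ t e b → b ≢ e → t e ≡ e → (∀ r → t r ≡ e → r ≡ e) →
       ι q * S (t ∘ transpose e b) ≡ - S t) →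
    ι (q ℕ.^ n) * ∑ (maps n n) (λ t → E t * S t) ≡ ι (rising q n) * S id
  signed-cycle-sum q zero S hc step =
    cong (ι 1 *_) (trans (∑-fun₀ (fin 0) _) (trans (*-identityˡ _) (hc λ ())))
  signed-cycle-sum q (suc n) S hc step = begin
    ι (q ℕ.* q ℕ.^ n) * ∑ (maps (suc n) (suc n)) (λ t → E t * S t)
      ≡⟨ cong₂ _*_ (trans (ι-* q (q ℕ.^ n)) (*-comm _ _)) (∑-E-transpose n S hc) ⟩
    ι (q ℕ.^ n) * ι q * ∑ (maps n n) (λ u → E u * (S′ u + - ∑ (fin n) (λ a → S (lift u ∘ transpose zero (suc a)))))
      ≡⟨ trans (*-assoc (ι (q ℕ.^ n)) (ι q) _)
           (cong (ι (q ℕ.^ n) *_) (trans (sym (∑-*ˡ (maps n n) (ι q) _)) (∑-cong (maps n n) inner))) ⟩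
    ι (q ℕ.^ n) * ∑ (maps n n) (λ u → ι (q ℕ.+ n) * (E u * S′ u))
      ≡⟨ cong (ι (q ℕ.^ n) *_) (∑-*ˡ (maps n n) (ι (q ℕ.+ n)) _) ⟩
    ι (q ℕ.^ n) * (ι (q ℕ.+ n) * ∑ (maps n n) (λ u → E u * S′ u))
      ≡⟨ *-swap (ι (q ℕ.^ n)) (ι (q ℕ.+ n)) _ ⟩
    ι (q ℕ.+ n) * (ι (q ℕ.^ n) * ∑ (maps n n) (λ u → E u * S′ u))
      ≡⟨ cong (ι (q ℕ.+ n) *_) (signed-cycle-sum q n S′ (λ eq → hc (lift-cong eq)) step′) ⟩
    ι (q ℕ.+ n) * (ι (rising q n) * S (lift id))
      ≡⟨ *-assoc (ι (q ℕ.+ n)) _ _ ⟨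
    ι (q ℕ.+ n) * ι (rising q n) * S (lift id)
      ≡⟨ cong₂ _*_ (sym (ι-* (q ℕ.+ n) (rising q n))) (hc λ { zero → refl ; (suc i) → refl }) ⟩
    ι (rising q (suc n)) * S id ∎
    where
    S′ : (Fin n → Fin n) → ℤ
    S′ u = S (lift u)
    step′ : ∀ t e b → b ≢ e → t e ≡ e → (∀ r → t r ≡ e → r ≡ e) → ι q * S′ (t ∘ transpose e b) ≡ - S′ t
    step′ t e b b≢e te unique = trans (cong (ι q *_) (hc (lift-transpose t e b)))
      (step (lift t) (suc e) (suc b) (b≢e ∘ suc-injective) (cong suc te)
        (λ { (suc r) eq → cong suc (unique r (suc-injective eq)) }))
    -- The new point 0 is either fixed, contributing `q`, or spliced into `u` by one of `n`
    -- transpositions. For each of these the sign -1 and the factor -1/q from `step` leave 1 after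
    -- multiplication by `q`, whence the total `q + n`.
    inner : ∀ u → ι q * (E u * (S′ u + - ∑ (fin n) (λ a → S (lift u ∘ transpose zero (suc a)))))
                ≡ ι (q ℕ.+ n) * (E u * S′ u)
    inner u = begin
      ι q * (E u * (S′ u + - ∑ (fin n) T))
        ≡⟨ *-swap (ι q) (E u) _ ⟩
      E u * (ι q * (S′ u + - ∑ (fin n) T))
        ≡⟨ cong (E u *_) (distribˡ (ι q) (S′ u) _) ⟩
      E u * (ι q * S′ u + ι q * - ∑ (fin n) T)
        ≡⟨ cong (λ x → E u * (ι q * S′ u + x)) (begin
          ι q * - ∑ (fin n) T          ≡⟨ -‿distribʳ-* (ι q) _ ⟨
          - (ι q * ∑ (fin n) T)        ≡⟨ cong -_ (sym (∑-*ˡ (fin n) (ι q) T)) ⟩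
          - ∑ (fin n) (λ a → ι q * T a)
            ≡⟨ cong -_ (∑-cong (fin n) (λ a → step (lift u) zero (suc a) (λ ()) refl λ { zero _ → refl })) ⟩
          - ∑ (fin n) (λ _ → - S′ u)   ≡⟨ ∑-neg (fin n) _ ⟨
          ∑ (fin n) (λ _ → - - S′ u)   ≡⟨ ∑-cong (fin n) (λ _ → -‿involutive (S′ u)) ⟩
          ∑ (fin n) (λ _ → S′ u)       ≡⟨ ∑-const n (S′ u) ⟩
          ι n * S′ u ∎) ⟩
      E u * (ι q * S′ u + ι n * S′ u)
        ≡⟨ cong (E u *_) (trans (sym (distribʳ (S′ u) (ι q) (ι n))) (cong (_* S′ u) (sym (ι-+ q n)))) ⟩
      E u * (ι (q ℕ.+ n) * S′ u)
        ≡⟨ *-swap (E u) (ι (q ℕ.+ n)) (S′ u) ⟩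
      ι (q ℕ.+ n) * (E u * S′ u) ∎
      where
      T : Fin n → ℤ
      T a = S (lift u ∘ transpose zero (suc a))

  -- Words under the special linear Lie algebra

  Word : ℕ → ℕ → Set
  Word n s = Fin n → Fin s → Fin n

  words : ∀ n s → Enum (Word n s)
  words n s = fun n (maps s n)

  _[_⨾_≔_] : Word n s → Fin n → Fin s → Fin n → Word n s
  K [ a ⨾ c ≔ x ] = K [ a ≔ K a [ c ≔ x ] ]

  ≔₂-row : ∀ (K : Word n s) a c x c′ → (K [ a ⨾ c ≔ x ]) a c′ ≡ (K a [ c ≔ x ]) c′
  ≔₂-row K a c x c′ = cong (λ r → r c′) (≔-hit K a (K a [ c ≔ x ]))

  ≔₂-miss : ∀ (K : Word n s) {a a′} c x c′ → a′ ≢ a → (K [ a ⨾ c ≔ x ]) a′ c′ ≡ K a′ c′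
  ≔₂-miss K {a} c x c′ a′≢a = cong (λ r → r c′) (≔-miss K (K a [ c ≔ x ]) a′≢a)

  ≔₂-unique : ∀ (K L : Word n s) a c x → L a c ≡ x → (∀ c′ → c′ ≢ c → L a c′ ≡ K a c′) →
              (∀ a′ → a′ ≢ a → ∀ c′ → L a′ c′ ≡ K a′ c′) → ∀ a′ c′ → (K [ a ⨾ c ≔ x ]) a′ c′ ≡ L a′ c′
  ≔₂-unique K L a c x hit row rest a′ c′ with a′ ≟ a
  ... | yes refl = trans (≔₂-row K a c x c′) (≔-unique (K a) (L a) c x hit row c′)
  ... | no a′≢a  = trans (≔₂-miss K c x c′ a′≢a) (sym (rest a′ a′≢a c′))

  -- Invariance under the elementary matrices of sl n, acting as derivations on
  -- the letters.
  Invariant : ∀ n s → (Word n s → ℤ) → Set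
  Invariant n s f = ∀ i j → i ≢ j → ∀ K →
    ∑ (fin n) (λ a → ∑ (fin s) (λ c → ⟦ K a c ≟ i ⟧ * f (K [ a ⨾ c ≔ j ]))) ≡ 0ℤ

  base : ∀ n s → Word n s
  base n s a c = a

  marked : (Fin n → Fin s) → (Fin n → Fin n) → Word n s
  marked c t a = (λ _ → a) [ c a ≔ t a ]

  +-cancel-neg : ∀ x y → x + y ≡ 0ℤ → x ≡ - y
  +-cancel-neg x y eq = begin
    x             ≡⟨ +-identityʳ x ⟨
    x + 0ℤ        ≡⟨ cong (x +_) (sym (-‿inverseʳ y)) ⟩
    x + (y + - y) ≡⟨ +-assoc x y _ ⟨
    x + y + - y   ≡⟨ cong (_+ - y) eq ⟩
    0ℤ + - y      ≡⟨ +-identityˡ _ ⟩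
    - y ∎

  -- The analogue of Cayley's identity, with `suc q` columns. The sum over the marks `c` is the
  -- function `S` to which `signed-cycle-sum` applies. For `t = id` the marks are invisible, and the
  -- `suc q ^ n` equal terms cancel the power that clears denominators.
  ∑-marked : ∀ n q (f : Word n (suc q) → ℤ) → Cong (words n (suc q)) f → Invariant n (suc q) f →
    ∑ (maps n n) (λ t → E t * ∑ (maps n (suc q)) (λ c → f (marked c t))) ≡ ι (rising (suc q) n) * f (base n (suc q))
  ∑-marked n q f fc inv = ι-cancelˡ (suc q ℕ.^ n) {{ℕₚ.m^n≢0 (suc q) n}} _ _ (begin
    ι (suc q ℕ.^ n) * ∑ (maps n n) (λ t → E t * S t)
      ≡⟨ signed-cycle-sum (suc q) n S
           (λ eq → ∑-cong (maps n (suc q)) (λ c → fc (λ a → ≔-cong (c a) (λ _ → refl) (eq a)))) step ⟩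
    ι (rising (suc q) n) * S id
      ≡⟨ cong (ι (rising (suc q) n) *_) (trans (∑-cong (maps n (suc q)) (λ c → fc (λ a → ≔-unique (λ _ → a) (λ _ → a) (c a) a refl (λ _ _ → refl))))
           (∑-const-maps n (f (base n (suc q))))) ⟩
    ι (rising (suc q) n) * (ι (suc q ℕ.^ n) * f (base n (suc q)))
      ≡⟨ *-swap (ι (rising (suc q) n)) _ _ ⟩
    ι (suc q ℕ.^ n) * (ι (rising (suc q) n) * f (base n (suc q))) ∎)
    where
    S : (Fin n → Fin n) → ℤ
    S t = ∑ (maps n (suc q)) (λ c → f (marked c t))
    ∑-const-maps : ∀ n x → ∑ (maps n (suc q)) (λ _ → x) ≡ ι (suc q ℕ.^ n) * x
    ∑-const-maps zero    x = trans (∑-fun₀ _ _) (sym (trans (cong (_* x) ι-1) (*-identityˡ x)))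
    ∑-const-maps (suc n) x = trans (∑-fun _ _) (trans (∑-cong (fin (suc q)) (λ _ → ∑-const-maps n x))
      (trans (∑-const (suc q) _) (trans (sym (*-assoc (ι (suc q)) (ι (suc q ℕ.^ n)) x)) (cong (_* x) (sym (ι-* (suc q) (suc q ℕ.^ n)))))))
    step : ∀ t e b → b ≢ e → t e ≡ e → (∀ r → t r ≡ e → r ≡ e) → ι (suc q) * S (t ∘ transpose e b) ≡ - S t
    step t e b b≢e te unique = begin
      ι (suc q) * S t′
        ≡⟨ ∑-update e (λ c → f (marked c t′)) (λ eq → fc (λ a i → cong (λ z → ((λ _ → a) [ z ≔ t′ a ]) i) (eq a))) ⟨
      ∑ (maps n (suc q)) (λ c → ∑ (fin (suc q)) (λ x → f (marked (c [ e ≔ x ]) t′)))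
        ≡⟨ ∑-cong (maps n (suc q)) (λ c → +-cancel-neg _ _ (relation c)) ⟩
      ∑ (maps n (suc q)) (λ c → - f (marked c t))
        ≡⟨ ∑-neg (maps n (suc q)) (λ c → f (marked c t)) ⟩
      - S t ∎
      where
      t′ = t ∘ transpose e b
      j = t b
      t′e : t′ e ≡ j
      t′e = cong t (proj₁ (transpose-Swap e b))
      t′b : t′ b ≡ e
      t′b = trans (cong t (proj₁ (proj₂ (transpose-Swap e b)))) te
      t′r : ∀ r → r ≢ e → r ≢ b → t′ r ≡ t r
      t′r r r≢e r≢b = cong t (proj₂ (proj₂ (transpose-Swap e b)) r r≢e r≢b)
      -- Invariance is applied to `K`, changing letters `e` into `j = t b`. In `K` the letter `e`
      -- fills row `e`, because `t` fixes `e`, and occurs elsewhere only in the marked cell of row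
      -- `b`. Changing it at column `x` of row `e` gives a word of `t′` with the mark of that row
      -- moved to `x`; changing it in row `b` gives the word of `t`. Summing over `c` turns the free
      -- choice of `x` into the factor `suc q`.
      relation : ∀ c → ∑ (fin (suc q)) (λ x → f (marked (c [ e ≔ x ]) t′)) + f (marked c t) ≡ 0ℤ
      relation c = trans (sym (begin
        ∑ (fin n) (λ a → ∑ (fin (suc q)) (λ x → ⟦ K a x ≟ e ⟧ * f (K [ a ⨾ x ≔ j ])))
          ≡⟨ ∑-cong (fin n) (λ a → trans (∑-cong (fin (suc q)) (split a)) (trans (∑-+ (fin (suc q)) _ _)
               (cong₂ _+_ (∑-*ˡ (fin (suc q)) ⟦ a ≟ e ⟧ _)
                  (trans (∑-*ˡ (fin (suc q)) ⟦ a ≟ b ⟧ _)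
                         (cong (⟦ a ≟ b ⟧ *_) (∑-fin-pick (suc q) (λ _ → f (marked c t)) (c a))))))) ⟩
        ∑ (fin n) (λ a → ⟦ a ≟ e ⟧ * X + ⟦ a ≟ b ⟧ * f (marked c t))
          ≡⟨ ∑-+ (fin n) _ _ ⟩
        ∑ (fin n) (λ a → ⟦ a ≟ e ⟧ * X) + ∑ (fin n) (λ a → ⟦ a ≟ b ⟧ * f (marked c t))
          ≡⟨ cong₂ _+_ (∑-fin-pick n (λ _ → X) e) (∑-fin-pick n (λ _ → f (marked c t)) b) ⟩
        X + f (marked c t) ∎)) (inv e j (λ e≡j → b≢e (unique b (sym e≡j))) K)
        where
        X : ℤ
        X = ∑ (fin (suc q)) (λ x → f (marked (c [ e ≔ x ]) t′))
        K : Word n (suc q)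
        K = marked c (t [ b ≔ e ])
        K-b : K b (c b) ≡ e
        K-b = trans (≔-hit (λ _ → b) (c b) _) (≔-hit t b e)
        K-b′ : ∀ x → x ≢ c b → K b x ≡ b
        K-b′ x x≢ = ≔-miss (λ _ → b) _ x≢
        K-a : ∀ a x → a ≢ b → K a x ≡ marked c t a x
        K-a a x a≢b = ≔-cong (c a) (λ _ → refl) (≔-miss t e a≢b) x
        K-e : ∀ x → K e x ≡ e
        K-e x = ≔-unique (λ _ → e) (λ _ → e) (c e) _ (sym (trans (≔-miss t e (b≢e ∘ sym)) te)) (λ _ _ → refl) x
        marked≢e : ∀ a x → a ≢ e → marked c t a x ≢ e
        marked≢e a x a≢e = at (x ≟ c a)
          where
          at : Dec (x ≡ c a) → marked c t a x ≢ e
          at (yes refl) eq = a≢e (unique a (trans (sym (≔-hit (λ _ → a) (c a) (t a))) eq))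
          at (no x≢)    eq = a≢e (trans (sym (≔-miss (λ _ → a) (t a) x≢)) eq)
        at-e : ∀ x → f (K [ e ⨾ x ≔ j ]) ≡ f (marked (c [ e ≔ x ]) t′)
        at-e x = fc (≔₂-unique K (marked (c [ e ≔ x ]) t′) e x j
          (trans (cong (marked (c [ e ≔ x ]) t′ e) (sym (≔-hit c e x))) (trans (≔-hit (λ _ → e) ((c [ e ≔ x ]) e) (t′ e)) t′e))
          (λ x′ x′≢x → trans (≔-miss (λ _ → e) (t′ e) (λ eq → x′≢x (trans eq (≔-hit c e x)))) (sym (K-e x′)))
          (λ a a≢e x′ → trans (cong (λ z → ((λ _ → a) [ z ≔ t′ a ]) x′) (≔-miss c x a≢e))
             (≔-cong (c a) (λ _ → refl) (t′-row a a≢e) x′)))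
          where
          t′-row : ∀ a → a ≢ e → t′ a ≡ (t [ b ≔ e ]) a
          t′-row a a≢e with a ≟ b
          ... | yes refl = trans t′b (sym (≔-hit t b e))
          ... | no a≢b   = trans (t′r a a≢e a≢b) (sym (≔-miss t e a≢b))
        at-b : f (K [ b ⨾ c b ≔ j ]) ≡ f (marked c t)
        at-b = fc (≔₂-unique K (marked c t) b (c b) j (≔-hit (λ _ → b) (c b) (t b))
          (λ x x≢ → trans (≔-miss (λ _ → b) (t b) x≢) (sym (K-b′ x x≢)))
          (λ a a≢b x → sym (K-a a x a≢b)))
        split : ∀ a x → ⟦ K a x ≟ e ⟧ * f (K [ a ⨾ x ≔ j ])
                      ≡ ⟦ a ≟ e ⟧ * f (marked (c [ e ≔ x ]) t′) + ⟦ a ≟ b ⟧ * (⟦ x ≟ c a ⟧ * f (marked c t))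
        split a x = at (a ≟ e) (a ≟ b) (x ≟ c a)
          where
          at : Dec (a ≡ e) → Dec (a ≡ b) → Dec (x ≡ c a) →
            ⟦ K a x ≟ e ⟧ * f (K [ a ⨾ x ≔ j ])
            ≡ ⟦ a ≟ e ⟧ * f (marked (c [ e ≔ x ]) t′) + ⟦ a ≟ b ⟧ * (⟦ x ≟ c a ⟧ * f (marked c t))
          at (yes refl) _ _ = begin
            ⟦ K e x ≟ e ⟧ * f (K [ e ⨾ x ≔ j ]) ≡⟨ ⟦⟧-yes (K e x ≟ e) (K-e x) ⟩
            f (K [ e ⨾ x ≔ j ])                 ≡⟨ at-e x ⟩
            f (marked (c [ e ≔ x ]) t′)         ≡⟨ +-identityʳ _ ⟨
            f (marked (c [ e ≔ x ]) t′) + 0ℤ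
              ≡⟨ cong₂ _+_ (sym (⟦⟧-yes (e ≟ e) refl)) (sym (⟦⟧-no (e ≟ b) (b≢e ∘ sym))) ⟩
            _ ∎
          at (no a≢e) (yes refl) (yes refl) = begin
            ⟦ K b (c b) ≟ e ⟧ * f (K [ b ⨾ c b ≔ j ]) ≡⟨ ⟦⟧-yes (K b (c b) ≟ e) K-b ⟩
            f (K [ b ⨾ c b ≔ j ])                     ≡⟨ at-b ⟩
            f (marked c t)                            ≡⟨ +-identityˡ _ ⟨
            0ℤ + f (marked c t)
              ≡⟨ cong₂ _+_ (sym (⟦⟧-no (b ≟ e) b≢e))
                   (sym (trans (⟦⟧-yes (b ≟ b) refl) (⟦⟧-yes (c b ≟ c b) refl))) ⟩
            _ ∎
          at (no a≢e) (yes refl) (no x≢) = begin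
            ⟦ K b x ≟ e ⟧ * f (K [ b ⨾ x ≔ j ])
              ≡⟨ ⟦⟧-no (K b x ≟ e) (λ eq → b≢e (trans (sym (K-b′ x x≢)) eq)) ⟩
            0ℤ          ≡⟨ +-identityʳ 0ℤ ⟨
            0ℤ + 0ℤ
              ≡⟨ cong₂ _+_ (sym (⟦⟧-no (b ≟ e) b≢e))
                   (sym (trans (⟦⟧-yes (b ≟ b) refl) (⟦⟧-no (x ≟ c b) x≢))) ⟩
            _ ∎
          at (no a≢e) (no a≢b) _ = begin
            ⟦ K a x ≟ e ⟧ * f (K [ a ⨾ x ≔ j ])
              ≡⟨ ⟦⟧-no (K a x ≟ e) (λ eq → marked≢e a x a≢e (trans (sym (K-a a x a≢b)) eq)) ⟩
            0ℤ          ≡⟨ +-identityʳ 0ℤ ⟨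
            0ℤ + 0ℤ     ≡⟨ cong₂ _+_ (sym (⟦⟧-no (a ≟ e) a≢e)) (sym (⟦⟧-no (a ≟ b) a≢b)) ⟩
            _ ∎

  -- The symmetrizer on invariant functions

  ∑-remove : ∀ {n} (c : Fin (suc n)) (g : Fin (suc n) → ℤ) →
             ∑ (fin (suc n)) g ≡ g c + ∑ (fin n) (g ∘ punchIn c)
  ∑-remove         zero    g = ∑-fin _ g
  ∑-remove {suc n} (suc c) g = begin
    ∑ (fin (suc (suc n))) g                                      ≡⟨ ∑-fin _ g ⟩
    g zero + ∑ (fin (suc n)) (g ∘ suc)                           ≡⟨ cong (g zero +_) (∑-remove c (g ∘ suc)) ⟩
    g zero + (g (suc c) + ∑ (fin n) (g ∘ suc ∘ punchIn c))       ≡⟨ +-assoc (g zero) (g (suc c)) _ ⟨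
    g zero + g (suc c) + ∑ (fin n) (g ∘ suc ∘ punchIn c)         ≡⟨ cong₂ _+_ (+-comm (g zero) (g (suc c))) refl ⟩
    g (suc c) + g zero + ∑ (fin n) (g ∘ suc ∘ punchIn c)         ≡⟨ +-assoc (g (suc c)) (g zero) _ ⟩
    g (suc c) + (g zero + ∑ (fin n) (g ∘ suc ∘ punchIn c))       ≡⟨ cong (g (suc c) +_) (sym (∑-fin n _)) ⟩
    g (suc c) + ∑ (fin (suc n)) (g ∘ punchIn (suc c))            ∎

  insert-≔-hit : ∀ (r : Fin m → A) c x y i → (F.insertAt r c x [ c ≔ y ]) i ≡ F.insertAt r c y i
  insert-≔-hit         r zero    x y zero    = refl
  insert-≔-hit         r zero    x y (suc i) = refl
  insert-≔-hit {suc m} r (suc c) x y zero    = refl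
  insert-≔-hit {suc m} r (suc c) x y (suc i) = insert-≔-hit (r ∘ suc) c x y i

  insert-≔-miss : ∀ (r : Fin m → A) c x d y i →
                  (F.insertAt r c x [ punchIn c d ≔ y ]) i ≡ F.insertAt (r [ d ≔ y ]) c x i
  insert-≔-miss         r zero    x d       y zero    = refl
  insert-≔-miss {suc m} r zero    x zero    y (suc zero)    = refl
  insert-≔-miss {suc m} r zero    x zero    y (suc (suc i)) = refl
  insert-≔-miss {suc m} r zero    x (suc d) y (suc zero)    = refl
  insert-≔-miss {suc m} r zero    x (suc d) y (suc (suc i)) = refl
  insert-≔-miss {suc m} r (suc c) x zero    y zero    = refl
  insert-≔-miss {suc m} r (suc c) x (suc d) y zero    = refl
  insert-≔-miss {suc m} r (suc c) x zero    y (suc i) = refl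
  insert-≔-miss {suc m} r (suc c) x (suc d) y (suc i) = insert-≔-miss (r ∘ suc) c x d y i

  insertAt-congˣ : ∀ {u v : Fin m → A} c {x y} → (∀ i → u i ≡ v i) → x ≡ y → ∀ i → F.insertAt u c x i ≡ F.insertAt v c y i
  insertAt-congˣ c {x} eq refl = insertAt-cong c x eq

  insertRows : Word n s → (Fin n → Fin (suc s)) → (Fin n → Fin n) → Word n (suc s)
  insertRows K c t a = F.insertAt (K a) (c a) (t a)

  insertRows-cong : ∀ {K L : Word n s} (c : Fin n → Fin (suc s)) {t u} → (∀ a i → K a i ≡ L a i) → (∀ a → t a ≡ u a) →
                    ∀ a i → insertRows K c t a i ≡ insertRows L c u a i
  insertRows-cong c p q a = insertAt-congˣ (c a) (p a) (q a)

  insertRows-base : ∀ (c : Fin n → Fin (suc s)) t a i → insertRows (base n s) c t a i ≡ marked c t a i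
  insertRows-base c t a i = trans (sym (insert-≔-hit (λ _ → a) (c a) a (t a) i))
    (≔-cong (c a) (all-a (c a)) refl i)
    where
    all-a : ∀ {s} (c : Fin (suc s)) i → F.insertAt {n = s} (λ _ → a) c a i ≡ a
    all-a         zero    zero    = refl
    all-a         zero    (suc i) = refl
    all-a {suc s} (suc c) zero    = refl
    all-a {suc s} (suc c) (suc i) = all-a c i

  -- Contracts one cell of each row, the one in column `c a`, against the determinant. The result is
  -- a function of words with one column fewer.
  antisymmetrize : (Word n (suc s) → ℤ) → (Fin n → Fin (suc s)) → Word n s → ℤ
  antisymmetrize {n} f c K = ∑ (maps n n) (λ t → E t * f (insertRows K c t))

  -- The relation for `f` on the enlarged word splits into changes of old cells and changes of
  -- inserted cells. In the second part `∑-replace` moves the change of letter from `f` to the sign,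
  -- where `E-polarize` makes it vanish: the determinant is itself invariant.
  antisymmetrize-invariant : ∀ (f : Word n (suc s) → ℤ) → Cong (words n (suc s)) f → Invariant n (suc s) f →
                             ∀ c → Invariant n s (antisymmetrize f c)
  antisymmetrize-invariant {n} {s} f fc inv c i j i≢j K = begin
    ∑ (fin n) (λ a → ∑ (fin s) (λ d → ⟦ K a d ≟ i ⟧ * ∑ (maps n n) (λ t → E t * g a d t)))
      ≡⟨ ∑-cong (fin n) (λ a → trans (∑-cong (fin s) (λ d → trans (sym (∑-*ˡ (maps n n) ⟦ K a d ≟ i ⟧ _))
           (∑-cong (maps n n) (λ t → *-swap ⟦ K a d ≟ i ⟧ (E t) (g a d t)))))
           (trans (∑-comm (fin s) (maps n n) _) (∑-cong (maps n n) (λ t → ∑-*ˡ (fin s) (E t) _)))) ⟩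
    ∑ (fin n) (λ a → ∑ (maps n n) (λ t → E t * ∑ (fin s) (λ d → ⟦ K a d ≟ i ⟧ * g a d t)))
      ≡⟨ trans (∑-comm (fin n) (maps n n) _) (∑-cong (maps n n) (λ t → ∑-*ˡ (fin n) (E t) _)) ⟩
    ∑ (maps n n) (λ t → E t * ∑ (fin n) (λ a → ∑ (fin s) (λ d → ⟦ K a d ≟ i ⟧ * g a d t)))
      ≡⟨ ∑-cong (maps n n) (λ t → cong (E t *_) (+-cancel-neg _ _ (trans (+-comm _ _) (relation t)))) ⟩
    ∑ (maps n n) (λ t → E t * - ∑ (fin n) (λ a → ⟦ t a ≟ i ⟧ * f (insertRows K c (t [ a ≔ j ]))))
      ≡⟨ ∑-cong (maps n n) (λ t → trans (sym (-‿distribʳ-* (E t) _)) (cong -_ (trans (sym (∑-*ˡ (fin n) (E t) _))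
           (∑-cong (fin n) (λ a → *-swap (E t) ⟦ t a ≟ i ⟧ _))))) ⟩
    ∑ (maps n n) (λ t → - ∑ (fin n) (λ a → ⟦ t a ≟ i ⟧ * (E t * f (insertRows K c (t [ a ≔ j ])))))
      ≡⟨ trans (∑-neg (maps n n) _) (cong -_ (∑-comm (maps n n) (fin n) _)) ⟩
    - ∑ (fin n) (λ a → ∑ (maps n n) (λ t → ⟦ t a ≟ i ⟧ * (E t * f (insertRows K c (t [ a ≔ j ])))))
      ≡⟨ cong -_ (∑-cong (fin n) (λ a → ∑-replace a i j (λ v w → E v * f (insertRows K c w))
           (λ p q → cong₂ _*_ (E-cong p) (fc (insertRows-cong c (λ _ _ → refl) q))))) ⟩
    - ∑ (fin n) (λ a → ∑ (maps n n) (λ t → ⟦ t a ≟ j ⟧ * (E (t [ a ≔ i ]) * f (insertRows K c t))))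
      ≡⟨ cong -_ (trans (∑-comm (fin n) (maps n n) _) (∑-zero (maps n n) (λ t → trans
           (∑-cong (fin n) (λ a → sym (*-assoc ⟦ t a ≟ j ⟧ (E (t [ a ≔ i ])) (f (insertRows K c t)))))
           (trans (∑-*ʳ (fin n) (f (insertRows K c t)) _) (zero* (E-polarize t (i≢j ∘ sym))))))) ⟩
    - 0ℤ
      ≡⟨ -0#≈0# ⟩
    0ℤ ∎
    where
    g : Fin n → Fin s → (Fin n → Fin n) → ℤ
    g a d t = f (insertRows (K [ a ⨾ d ≔ j ]) c t)
    relation : ∀ t → ∑ (fin n) (λ a → ⟦ t a ≟ i ⟧ * f (insertRows K c (t [ a ≔ j ])))
                   + ∑ (fin n) (λ a → ∑ (fin s) (λ d → ⟦ K a d ≟ i ⟧ * g a d t)) ≡ 0ℤ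
    relation t = trans (sym (∑-+ (fin n) _ _)) (trans (∑-cong (fin n) (λ a → sym (trans
      (∑-remove (c a) (λ d → ⟦ L a d ≟ i ⟧ * f (L [ a ⨾ d ≔ j ])))
      (cong₂ _+_
        (cong₂ _*_ (cong (λ x → ⟦ x ≟ i ⟧) (insertAt-lookup (K a) (c a) (t a))) (fc (marked-row a)))
        (∑-cong (fin s) (λ d → cong₂ _*_ (cong (λ x → ⟦ x ≟ i ⟧) (insertAt-punchIn (K a) (c a) (t a) d))
          (fc (other-row a d)))))))) (inv i j i≢j L))
      where
      L : Word n (suc s)
      L = insertRows K c t
      marked-row : ∀ a a′ d′ → (L [ a ⨾ c a ≔ j ]) a′ d′ ≡ insertRows K c (t [ a ≔ j ]) a′ d′
      marked-row a a′ d′ with a′ ≟ a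
      ... | yes refl = trans (≔₂-row L a (c a) j d′) (trans (insert-≔-hit (K a) (c a) (t a) j d′)
                         (insertAt-congˣ (c a) (λ _ → refl) (sym (≔-hit t a j)) d′))
      ... | no a′≢a  = trans (≔₂-miss L (c a) j d′ a′≢a)
                         (insertAt-congˣ (c a′) (λ _ → refl) (sym (≔-miss t j a′≢a)) d′)
      other-row : ∀ a d a′ d′ → (L [ a ⨾ punchIn (c a) d ≔ j ]) a′ d′ ≡ insertRows (K [ a ⨾ d ≔ j ]) c t a′ d′
      other-row a d a′ d′ with a′ ≟ a
      ... | yes refl = trans (≔₂-row L a (punchIn (c a) d) j d′) (trans (insert-≔-miss (K a) (c a) (t a) d j d′)
                         (insertAt-cong (c a) (t a) (λ i → sym (≔₂-row K a d j i)) d′))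
      ... | no a′≢a  = trans (≔₂-miss L (punchIn (c a) d) j d′ a′≢a)
                         (insertAt-cong (c a′) (t a′) (λ i → sym (≔₂-miss K d j i a′≢a)) d′)

  ∏-sq : (Fin n → Fin m → Fin k) → ℤ
  ∏-sq σ = ∏ (λ a → sq (σ a))

  -- Here `c a` is the place at which the permutation of row `a` takes the value 0; removing it
  -- leaves a permutation of `s` places, with the same weight.
  ∑-rows-insert : ∀ n s (G : (Fin n → Fin (suc s) → Fin (suc s)) → ℤ) → Cong (fun n (maps (suc s) (suc s))) G →
    ∑ (fun n (maps (suc s) (suc s))) (λ σ → ∏-sq σ * G σ) ≡
    ∑ (maps n (suc s)) (λ c → ∑ (fun n (maps s s)) (λ σ → ∏-sq σ * G (λ a → insert₀ (σ a) (c a))))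
  ∑-rows-insert zero s G gc = trans (∑-fun₀ _ _) (trans (cong (1ℤ *_) (gc λ ()))
    (sym (trans (∑-fun₀ _ _) (∑-fun₀ _ _))))
  ∑-rows-insert (suc n) s G gc = begin
    ∑ (fun (suc n) S₊) (λ σ → ∏-sq σ * G σ)
      ≡⟨ ∑-fun S₊ _ ⟩
    ∑ S₊ (λ v → ∑ (fun n S₊) (λ σ → (sq v * ∏-sq σ) * G (v F.∷ σ)))
      ≡⟨ ∑-cong S₊ (λ v → trans (∑-cong (fun n S₊) (λ σ → *-assoc (sq v) (∏-sq σ) _)) (∑-*ˡ (fun n S₊) (sq v) _)) ⟩
    ∑ S₊ (λ v → sq v * ∑ (fun n S₊) (λ σ → ∏-sq σ * G (v F.∷ σ)))
      ≡⟨ ∑-sq-insert s _ (λ eq → ∑-cong (fun n S₊) (λ σ → cong (∏-sq σ *_) (gc λ { zero → eq ; (suc a) _ → refl }))) ⟩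
    ∑ (fin (suc s)) (λ d → ∑ S (λ u → sq u * ∑ (fun n S₊) (λ σ → ∏-sq σ * G (insert₀ u d F.∷ σ))))
      ≡⟨ ∑-cong (fin (suc s)) (λ d → ∑-cong S (λ u → cong (sq u *_)
           (∑-rows-insert n s (λ σ → G (insert₀ u d F.∷ σ)) (λ eq → gc λ { zero _ → refl ; (suc a) → eq a })))) ⟩
    ∑ (fin (suc s)) (λ d → ∑ S (λ u → sq u * ∑ (maps n (suc s)) (λ c → ∑ (fun n S) (λ σ →
      ∏-sq σ * G (insert₀ u d F.∷ (λ a → insert₀ (σ a) (c a)))))))
      ≡⟨ ∑-cong (fin (suc s)) (λ d → trans (∑-cong S (λ u → trans (sym (∑-*ˡ (maps n (suc s)) (sq u) _))
           (∑-cong (maps n (suc s)) (λ c → trans (sym (∑-*ˡ (fun n S) (sq u) _))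
             (∑-cong (fun n S) (λ σ → trans (sym (*-assoc (sq u) (∏-sq σ) _))
               (cong (sq u * ∏-sq σ *_) (gc λ { zero _ → refl ; (suc a) _ → refl }))))))))
           (∑-comm S (maps n (suc s)) _)) ⟩
    ∑ (fin (suc s)) (λ d → ∑ (maps n (suc s)) (λ c → ∑ S (λ u → ∑ (fun n S) (λ σ →
      (sq u * ∏-sq σ) * G (λ a → insert₀ ((u F.∷ σ) a) ((d F.∷ c) a))))))
      ≡⟨ trans (∑-fun (fin (suc s)) _) (∑-cong (fin (suc s)) (λ d → ∑-cong (maps n (suc s)) (λ c → ∑-fun S _))) ⟨
    ∑ (maps (suc n) (suc s)) (λ c → ∑ (fun (suc n) S) (λ σ → ∏-sq σ * G (λ a → insert₀ (σ a) (c a)))) ∎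
    where
    S₊ = maps (suc s) (suc s)
    S  = maps s s

  columnSigns : (Fin s → Fin n → Fin n) → ℤ
  columnSigns K = ∏ (λ c → E (K c))

  shuffle : (Fin s → Fin n → Fin n) → (Fin n → Fin s → Fin s) → Word n s
  shuffle K σ a c = K (σ a c) a

  -- The Young symmetrizer of the rectangle with `n` rows and `s` columns, paired with `f`. The row
  -- permutations carry no sign, since `∏-sq` is merely the indicator that every `σ a` is a
  -- permutation.
  symmetrizer : ∀ n s → (Word n s → ℤ) → ℤ
  symmetrizer n s f =
    ∑ (fun n (maps s s)) (λ σ → ∏-sq σ * ∑ (fun s (maps n n)) (λ K → columnSigns K * f (shuffle K σ)))

  -- the product of the hook lengths of the n × s rectangle
  hooks : ℕ → ℕ → ℕ
  hooks n zero    = 1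
  hooks n (suc s) = rising (suc s) n ℕ.* hooks n s

  shuffle-insert : ∀ (t : Fin n → Fin n) (K : Fin s → Fin n → Fin n) σ c a i →
    shuffle (t F.∷ K) (λ a → insert₀ (σ a) (c a)) a i ≡ insertRows (shuffle K σ) c t a i
  shuffle-insert t K σ c a i = go (σ a) (c a) i
    where
    go : ∀ {m} (u : Fin m → _) d i → (t F.∷ K) (insert₀ u d i) a ≡ F.insertAt (λ c → K (u c) a) d (t a) i
    go         u zero    zero    = refl
    go         u zero    (suc i) = refl
    go {suc m} u (suc d) zero    = refl
    go {suc m} u (suc d) (suc i) = go (u ∘ suc) d i

  -- Induction on the number of columns. Column 0 is filled by a permutation `t` whose letter in row
  -- `a` is carried to place `c a`. Summing over `t` first leaves the symmetrizer on `s` columns of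
  -- `antisymmetrize f c`, which is invariant again. The induction hypothesis evaluates it at
  -- `base`, and the remaining sum over `c` and `t` is `∑-marked`.
  symmetrizer-invariant : ∀ n s (f : Word n s → ℤ) → Cong (words n s) f → Invariant n s f →
    symmetrizer n s f ≡ ι (hooks n s) * f (base n s)
  symmetrizer-invariant n zero f fc inv = trans (single n _ single-cong) (trans (cong₂ _*_ (∏-one n (λ _ → *-identityˡ 1ℤ))
      (trans (∑-fun₀ (maps n n) _) (trans (*-identityˡ _) (fc (λ a ())))))
      (cong (_* f (base n 0)) (sym ι-1)))
    where
    single-cong : Cong (fun n (maps 0 0)) (λ σ → ∏-sq σ * ∑ (fun 0 (maps n n)) (λ K → columnSigns K * f (shuffle K σ)))
    single-cong _ = cong₂ _*_ (∏-cong {n = n} (λ _ → refl))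
      (∑-cong (fun 0 (maps n n)) (λ K → cong (columnSigns K *_) (fc (λ a ()))))
    single : ∀ n (G : (Fin n → Fin 0 → Fin 0) → ℤ) → Cong (fun n (maps 0 0)) G → ∑ (fun n (maps 0 0)) G ≡ G (λ _ ())
    single zero    G gc = trans (∑-fun₀ (maps 0 0) G) (gc λ ())
    single (suc n) G gc = trans (∑-fun (maps 0 0) G) (trans (∑-fun₀ (fin 0) _)
      (trans (single n (λ σ → G (F.[] F.∷ σ)) (λ _ → gc λ a ())) (gc λ a ())))
  symmetrizer-invariant n (suc s) f fc inv = begin
    symmetrizer n (suc s) f
      ≡⟨ ∑-rows-insert n s (λ σ → ∑ (fun (suc s) (maps n n)) (λ K → columnSigns K * f (shuffle K σ)))
           (λ eq → ∑-cong (fun (suc s) (maps n n)) (λ K → cong (columnSigns K *_) (fc (λ a c → cong (λ z → K z a) (eq a c))))) ⟩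
    ∑ (maps n (suc s)) (λ c → ∑ (fun n (maps s s)) (λ σ → ∏-sq σ *
      ∑ (fun (suc s) (maps n n)) (λ K → columnSigns K * f (shuffle K (λ a → insert₀ (σ a) (c a))))))
      ≡⟨ ∑-cong (maps n (suc s)) (λ c → ∑-cong (fun n (maps s s)) (λ σ → cong (∏-sq σ *_) (peel c σ))) ⟩
    ∑ (maps n (suc s)) (λ c → symmetrizer n s (antisymmetrize f c))
      ≡⟨ ∑-cong (maps n (suc s)) (λ c → symmetrizer-invariant n s (antisymmetrize f c)
           (λ eq → ∑-cong (maps n n) (λ t → cong (E t *_) (fc (insertRows-cong c eq (λ _ → refl)))))
           (antisymmetrize-invariant f fc inv c)) ⟩
    ∑ (maps n (suc s)) (λ c → ι (hooks n s) * antisymmetrize f c (base n s))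
      ≡⟨ ∑-*ˡ (maps n (suc s)) (ι (hooks n s)) _ ⟩
    ι (hooks n s) * ∑ (maps n (suc s)) (λ c → antisymmetrize f c (base n s))
      ≡⟨ cong (ι (hooks n s) *_) (trans (∑-comm (maps n (suc s)) (maps n n) _) (∑-cong (maps n n) (λ t →
           trans (∑-*ˡ (maps n (suc s)) (E t) _)
             (cong (E t *_) (∑-cong (maps n (suc s)) (λ c → fc (insertRows-base c t))))))) ⟩
    ι (hooks n s) * ∑ (maps n n) (λ t → E t * ∑ (maps n (suc s)) (λ c → f (marked c t)))
      ≡⟨ cong (ι (hooks n s) *_) (∑-marked n s f fc inv) ⟩
    ι (hooks n s) * (ι (rising (suc s) n) * f (base n (suc s)))
      ≡⟨ trans (sym (*-assoc (ι (hooks n s)) _ _)) (cong (_* f (base n (suc s)))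
           (trans (*-comm _ _) (sym (ι-* (rising (suc s) n) (hooks n s))))) ⟩
    ι (hooks n (suc s)) * f (base n (suc s)) ∎
    where
    peel : ∀ c σ → ∑ (fun (suc s) (maps n n)) (λ K → columnSigns K * f (shuffle K (λ a → insert₀ (σ a) (c a))))
                 ≡ ∑ (fun s (maps n n)) (λ K → columnSigns K * antisymmetrize f c (shuffle K σ))
    peel c σ = begin
      ∑ (fun (suc s) (maps n n)) (λ K → columnSigns K * f (shuffle K (λ a → insert₀ (σ a) (c a))))
        ≡⟨ ∑-fun (maps n n) _ ⟩
      ∑ (maps n n) (λ t → ∑ (fun s (maps n n)) (λ K →
        (E t * columnSigns K) * f (shuffle (t F.∷ K) (λ a → insert₀ (σ a) (c a)))))
        ≡⟨ ∑-comm (maps n n) (fun s (maps n n)) _ ⟩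
      ∑ (fun s (maps n n)) (λ K → ∑ (maps n n) (λ t →
        (E t * columnSigns K) * f (shuffle (t F.∷ K) (λ a → insert₀ (σ a) (c a)))))
        ≡⟨ ∑-cong (fun s (maps n n)) (λ K → trans (∑-cong (maps n n) (λ t → trans
             (cong₂ _*_ (*-comm (E t) (columnSigns K)) (fc (shuffle-insert t K σ c)))
             (*-assoc (columnSigns K) (E t) _))) (∑-*ˡ (maps n n) (columnSigns K) _)) ⟩
      ∑ (fun s (maps n n)) (λ K → columnSigns K * antisymmetrize f c (shuffle K σ)) ∎

  -- The `s`-th power of the determinant, read as a function on words.
  transposedSigns : Word n s → ℤ
  transposedSigns K = columnSigns (λ c a → K a c)

  -- A change of letter affects one column; the signs of the other columns factor out, and
  -- `E-polarize` annihilates the sum within that column.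
  transposedSigns-invariant : ∀ n s → Invariant n s transposedSigns
  transposedSigns-invariant n s i j i≢j K = trans (∑-comm (fin n) (fin s) _) (∑-zero (fin s) (column s K))
    where
    column : ∀ s (K : Word n s) c → ∑ (fin n) (λ a → ⟦ K a c ≟ i ⟧ * transposedSigns (K [ a ⨾ c ≔ j ])) ≡ 0ℤ
    column (suc s) K c = begin
      ∑ (fin n) (λ a → ⟦ K a c ≟ i ⟧ * transposedSigns (K [ a ⨾ c ≔ j ]))
        ≡⟨ ∑-cong (fin n) (λ a → trans (cong (⟦ K a c ≟ i ⟧ *_) (trans
             (∏-remove {i = c} (λ d → E (λ b → (K [ a ⨾ c ≔ j ]) b d)))
             (cong₂ _*_ (E-cong (hit a)) (∏-cong (λ d → E-cong (λ b → miss a b d))))))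
             (sym (*-assoc ⟦ K a c ≟ i ⟧ _ rest))) ⟩
      ∑ (fin n) (λ a → ⟦ K a c ≟ i ⟧ * E ((λ b → K b c) [ a ≔ j ]) * rest)
        ≡⟨ ∑-*ʳ (fin n) rest _ ⟩
      ∑ (fin n) (λ a → ⟦ K a c ≟ i ⟧ * E ((λ b → K b c) [ a ≔ j ])) * rest
        ≡⟨ zero* (E-polarize (λ b → K b c) i≢j) ⟩
      0ℤ ∎
      where
      rest : ℤ
      rest = ∏ (λ d → E (λ b → K b (punchIn c d)))
      hit : ∀ a b → (K [ a ⨾ c ≔ j ]) b c ≡ ((λ b → K b c) [ a ≔ j ]) b
      hit a b with b ≟ a
      ... | yes refl = trans (≔₂-row K a c j c) (trans (≔-hit (K a) c j) (sym (≔-hit (λ b → K b c) a j)))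
      ... | no b≢a   = trans (≔₂-miss K c j c b≢a) (sym (≔-miss (λ b → K b c) j b≢a))
      miss : ∀ a b d → (K [ a ⨾ c ≔ j ]) b (punchIn c d) ≡ K b (punchIn c d)
      miss a b d with b ≟ a
      ... | yes refl = trans (≔₂-row K a c j (punchIn c d)) (≔-miss (K a) j (Finₚ.punchInᵢ≢i c d))
      ... | no b≢a   = ≔₂-miss K c j (punchIn c d) b≢a

  -- The matrix of the iterated product

  ∏-++ : ∀ m {k} (f : Fin (m ℕ.+ k) → ℤ) → ∏ f ≡ ∏ (λ i → f (i ↑ˡ k)) * ∏ (λ j → f (m ↑ʳ j))
  ∏-++ zero    f = sym (*-identityˡ _)
  ∏-++ (suc m) f = trans (cong (f zero *_) (∏-++ m (f ∘ suc))) (sym (*-assoc (f zero) _ _))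

  sg-↑ˡ : ∀ (x y : Fin m) k → sg (x ↑ˡ k) (y ↑ˡ k) ≡ sg x y
  sg-↑ˡ zero    zero    k = refl
  sg-↑ˡ zero    (suc y) k = refl
  sg-↑ˡ (suc x) zero    k = refl
  sg-↑ˡ (suc x) (suc y) k = sg-↑ˡ x y k

  sg-↑ʳ : ∀ m (x y : Fin k) → sg (m ↑ʳ x) (m ↑ʳ y) ≡ sg x y
  sg-↑ʳ zero    x y = refl
  sg-↑ʳ (suc m) x y = sg-↑ʳ m x y

  sg-↑ˡʳ : ∀ (x : Fin m) (y : Fin k) → sg (x ↑ˡ k) (m ↑ʳ y) ≡ 1ℤ
  sg-↑ˡʳ zero    y = refl
  sg-↑ˡʳ (suc x) y = sg-↑ˡʳ x y

  E-↑ʳ : ∀ s (v : Fin m → Fin k) → E (λ j → s ↑ʳ v j) ≡ E v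
  E-↑ʳ {zero}  s v = refl
  E-↑ʳ {suc m} s v = cong₂ _*_ (∏-cong (λ q → sg-↑ʳ s (v zero) (v (suc q)))) (E-↑ʳ s (v ∘ suc))

  -- Two consecutive blocks that are each preserved have no inversions between them.
  E-++ : ∀ m {k a b} (v : Fin (m ℕ.+ k) → Fin (a ℕ.+ b)) (u : Fin m → Fin a) (w : Fin k → Fin b) →
         (∀ i → v (i ↑ˡ k) ≡ u i ↑ˡ b) → (∀ j → v (m ↑ʳ j) ≡ a ↑ʳ w j) → E v ≡ E u * E w
  E-++ zero    {a = a} v u w p q = trans (E-cong q) (trans (E-↑ʳ a w) (sym (*-identityˡ _)))
  E-++ (suc m) {k} {a} {b} v u w p q = begin
    ∏ (λ r → sg (v zero) (v (suc r))) * E (v ∘ suc)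
      ≡⟨ cong₂ _*_ (trans (∏-++ m (λ r → sg (v zero) (v (suc r)))) (cong₂ _*_
          (∏-cong (λ i → trans (cong₂ sg (p zero) (p (suc i))) (sg-↑ˡ (u zero) (u (suc i)) b)))
          (∏-one k (λ j → trans (cong₂ sg (p zero) (q j)) (sg-↑ˡʳ (u zero) (w j))))))
          (E-++ m (v ∘ suc) (u ∘ suc) w (p ∘ suc) q) ⟩
    ∏ (λ i → sg (u zero) (u (suc i))) * 1ℤ * (E (u ∘ suc) * E w)
      ≡⟨ cong (_* (E (u ∘ suc) * E w)) (*-identityʳ _) ⟩
    ∏ (λ i → sg (u zero) (u (suc i))) * (E (u ∘ suc) * E w)
      ≡⟨ *-assoc (∏ (λ i → sg (u zero) (u (suc i)))) (E (u ∘ suc)) (E w) ⟨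
    E u * E w ∎

  quot : ∀ {m k} → Fin (m ℕ.* k) → Fin m
  quot {m} {k} p = proj₁ (remQuot {m} k p)

  rem : ∀ {m k} → Fin (m ℕ.* k) → Fin k
  rem {m} {k} p = proj₂ (remQuot {m} k p)

  combine-quot-rem : ∀ {m k} (p : Fin (m ℕ.* k)) → combine (quot {m} {k} p) (rem {m} {k} p) ≡ p
  combine-quot-rem {m} {k} p = combine-remQuot {m} k p

  quot-combine : ∀ (a : Fin m) (b : Fin k) → quot {m} {k} (combine a b) ≡ a
  quot-combine {m} {k} a b = cong proj₁ (remQuot-combine {m} {k} a b)

  rem-combine : ∀ (a : Fin m) (b : Fin k) → rem {m} {k} (combine a b) ≡ b
  rem-combine {m} {k} a b = cong proj₂ (remQuot-combine {m} {k} a b)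

  E-blocks : ∀ m {k} (v : Fin (m ℕ.* k) → Fin (m ℕ.* k)) (J : Fin m → Fin k → Fin k) →
             (∀ a j → v (combine a j) ≡ combine a (J a j)) → E v ≡ ∏ (λ a → E (J a))
  E-blocks zero        v J eq = refl
  E-blocks (suc m) {k} v J eq = trans
    (E-++ k v (J zero) w (eq zero)
       (λ p → trans (cong (λ z → v (k ↑ʳ z)) (sym (combine-quot-rem {m} {k} p))) (eq (suc (quot {m} {k} p)) (rem {m} {k} p))))
    (cong (E (J zero) *_) (E-blocks m w (J ∘ suc) (λ a j →
       cong₂ (λ a j → combine a (J (suc a) j)) (quot-combine a j) (rem-combine a j))))
    where
    w : Fin (m ℕ.* k) → Fin (m ℕ.* k)
    w p = combine (quot {m} {k} p) (J (suc (quot {m} {k} p)) (rem {m} {k} p))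

  ∑-sq : ∀ m → ∑ (maps m m) sq ≡ ι (m !)
  ∑-sq zero    = trans (∑-fun₀ (fin 0) sq) (trans (*-identityˡ 1ℤ) (sym ι-1))
  ∑-sq (suc m) = begin
    ∑ (maps (suc m) (suc m)) sq
      ≡⟨ ∑-cong (maps (suc m) (suc m)) (λ v → sym (*-identityʳ _)) ⟩
    ∑ (maps (suc m) (suc m)) (λ v → sq v * 1ℤ)
      ≡⟨ ∑-sq-insert m (λ _ → 1ℤ) (λ _ → refl) ⟩
    ∑ (fin (suc m)) (λ c → ∑ (maps m m) (λ u → sq u * 1ℤ))
      ≡⟨ ∑-cong (fin (suc m)) (λ c → trans (∑-cong (maps m m) (λ u → *-identityʳ _)) (∑-sq m)) ⟩
    ∑ (fin (suc m)) (λ c → ι (m !))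
      ≡⟨ ∑-const (suc m) (ι (m !)) ⟩
    ι (suc m) * ι (m !)
      ≡⟨ ι-* (suc m) (m !) ⟨
    ι (suc m !) ∎

  ∑-∘ : ∀ (X : Enum A) (w : Fin m → Fin m) → Inj w → ∀ h → Cong (fun m X) h →
        ∑ (fun m X) (λ K → h (K ∘ w)) ≡ ∑ (fun m X) h
  ∑-∘ {m = m} X w inj h hc = ∑-bij (fun m X) (fun m X) (_∘ w) (_∘ w⁻¹)
    (λ x y eq i → subst (λ z → Eq X (x z) (y (w⁻¹ i))) (ww⁻¹ i) (Eq-sym X (eq (w⁻¹ i))))
    (λ x y eq i → subst (λ z → Eq X (y z) (x (w i))) (w⁻¹w i) (Eq-sym X (eq (w i)))) h hc
    where
    w⁻¹ : Fin m → Fin m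
    w⁻¹ i = proj₁ (surjective w inj i)
    ww⁻¹ : ∀ i → w (w⁻¹ i) ≡ i
    ww⁻¹ i = proj₂ (surjective w inj i)
    w⁻¹w : ∀ i → w⁻¹ (w i) ≡ i
    w⁻¹w i = inj _ _ (ww⁻¹ (w i))
    Eq-sym : ∀ {A} (X : Enum A) {x y} → Eq X x y → Eq X y x
    Eq-sym (fin n)   p = sym p
    Eq-sym (fun m X) p i = Eq-sym X (p i)
    Eq-sym (X ⊗ Y)   (p , q) = Eq-sym X p , Eq-sym Y q

  -- The sign matrix of the n × n square and its powers

  module Square (n : ℕ) where
    N : ℕ
    N = n ℕ.* n

    Idx : Set
    Idx = Fin N → Fin n

    idx : Enum Idx
    idx = maps N n

    qt rm : Idx
    qt = quot {n} {n}
    rm = rem {n} {n}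

    pair : Idx → Idx → Fin N → Fin N
    pair I J p = combine (I p) (J p)

    pair-qt-rm : ∀ p → pair qt rm p ≡ p
    pair-qt-rm = combine-quot-rem {n} {n}

    W : Idx → Idx → ℤ
    W I J = E (pair I J)

    W-cong : ∀ {I I′ J J′} → (∀ p → I p ≡ I′ p) → (∀ p → J p ≡ J′ p) → W I J ≡ W I′ J′
    W-cong p q = E-cong (λ i → cong₂ combine (p i) (q i))

    W-∘ : ∀ I J w → W (I ∘ w) (J ∘ w) ≡ E w * W I J
    W-∘ I J w = E-∘ (pair I J) w

    flipIdx : Fin N → Fin N
    flipIdx p = combine {n} {n} (rm p) (qt p)

    flipIdx-combine : ∀ (a b : Fin n) → flipIdx (combine a b) ≡ combine b a
    flipIdx-combine a b = cong₂ (combine {n} {n}) (rem-combine {n} {n} a b) (quot-combine {n} {n} a b)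

    flipIdx-involutive : ∀ p → flipIdx (flipIdx p) ≡ p
    flipIdx-involutive p = trans (flipIdx-combine (rm p) (qt p)) (pair-qt-rm p)

    flipSign : ℤ
    flipSign = E flipIdx

    flipSign² : flipSign * flipSign ≡ 1ℤ
    flipSign² = E-sq flipIdx (λ p q eq →
      trans (sym (flipIdx-involutive p)) (trans (cong flipIdx eq) (flipIdx-involutive q)))

    W-flip : ∀ I J → W J I ≡ flipSign * W I J
    W-flip I J = trans (E-cong (λ p → sym (flipIdx-combine (I p) (J p))))
      (trans (E-∘ flipIdx (pair I J)) (*-comm _ _))

    -- The entries of `W Wᵗ W`. The transpose in the middle makes the signs pair up when the words
    -- are aligned; `flipSign` later converts it into the cube of `W`.
    Z : Idx → Idx → ℤ
    Z I L = ∑ idx (λ J → ∑ idx (λ K → W I J * (W K J * W K L)))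

    Z-cong : ∀ {I I′ L L′} → (∀ p → I p ≡ I′ p) → (∀ p → L p ≡ L′ p) → Z I L ≡ Z I′ L′
    Z-cong p q = ∑-cong idx (λ J → ∑-cong idx (λ K →
      cong₂ _*_ (W-cong p (λ _ → refl)) (cong (W K J *_) (W-cong (λ _ → refl) q))))

    -- Both inner words are reindexed by `w` as well. Each of the three factors then gives off
    -- `E w`, and two of these cancel.
    Z-∘ : ∀ I L w → Inj w → Z (I ∘ w) (L ∘ w) ≡ E w * Z I L
    Z-∘ I L w inj = begin
      Z (I ∘ w) (L ∘ w)
        ≡⟨ ∑-∘ (fin n) w inj (λ J → ∑ idx (λ K → W (I ∘ w) J * (W K J * W K (L ∘ w))))
             (λ eq → ∑-cong idx (λ K → cong₂ _*_ (W-cong (λ _ → refl) eq) (cong (_* W K (L ∘ w)) (W-cong (λ _ → refl) eq)))) ⟨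
      ∑ idx (λ J → ∑ idx (λ K → W (I ∘ w) (J ∘ w) * (W K (J ∘ w) * W K (L ∘ w))))
        ≡⟨ ∑-cong idx (λ J → ∑-∘ (fin n) w inj (λ K → W (I ∘ w) (J ∘ w) * (W K (J ∘ w) * W K (L ∘ w)))
             (λ eq → cong (W (I ∘ w) (J ∘ w) *_) (cong₂ _*_ (W-cong eq (λ _ → refl)) (W-cong eq (λ _ → refl))))) ⟨
      ∑ idx (λ J → ∑ idx (λ K → W (I ∘ w) (J ∘ w) * (W (K ∘ w) (J ∘ w) * W (K ∘ w) (L ∘ w))))
        ≡⟨ ∑-cong idx (λ J → trans (∑-cong idx (λ K → trans
             (cong₂ _*_ (W-∘ I J w) (trans (cong₂ _*_ (W-∘ K J w) (W-∘ K L w))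
               (trans (*-interchange (E w) _ (E w) _) (trans (cong₂ _*_ (E-sq w inj) refl) (*-identityˡ _)))))
             (*-assoc (E w) _ _))) (∑-*ˡ idx (E w) _)) ⟩
      ∑ idx (λ J → E w * ∑ idx (λ K → W I J * (W K J * W K L)))
        ≡⟨ ∑-*ˡ idx (E w) _ ⟩
      E w * Z I L ∎

    -- Z and W are both antisymmetric under simultaneous permutations of I and L.
    Z≡cW : ∀ I L → Z I L ≡ Z qt rm * W I L
    Z≡cW I L with inj-or-collision (pair I L)
    -- The words `I` and `L` are `qt` and `rm` reindexed by `pair I L`, whose sign is `W I L`.
    ... | inj₁ inj = trans
      (Z-cong (λ p → sym (quot-combine {n} {n} (I p) (L p))) (λ p → sym (rem-combine {n} {n} (I p) (L p))))
      (trans (Z-∘ qt rm (pair I L) inj) (*-comm _ _))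
    -- A repeated pair makes `I` and `L` invariant under the transposition of the two places, so
    -- `Z I L` equals its own negative.
    ... | inj₂ (p , q , p≢q , eq) = trans
      (self-neg⇒0 _ (trans (Z-cong (λ r → sym (fixed I Ip≡Iq r)) (λ r → sym (fixed L Lp≡Lq r)))
        (trans (Z-∘ I L τ τ-inj) (trans (cong (_* Z I L) (E-swap p≢q (transpose-Swap p q))) (-1*x≈-x _)))))
      (sym (trans (cong (Z qt rm *_) (E-collision (pair I L) (p , q , p≢q , eq))) (zeroʳ _)))
      where
      τ = transpose p q
      Ip≡Iq : I p ≡ I q
      Ip≡Iq = trans (sym (quot-combine (I p) (L p))) (trans (cong qt eq) (quot-combine (I q) (L q)))
      Lp≡Lq : L p ≡ L q
      Lp≡Lq = trans (sym (rem-combine (I p) (L p))) (trans (cong rm eq) (rem-combine (I q) (L q)))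
      fixed : ∀ (M : Idx) → M p ≡ M q → ∀ r → M (τ r) ≡ M r
      fixed M Mp≡Mq r = at (r ≟ p) (r ≟ q)
        where
        at : Dec (r ≡ p) → Dec (r ≡ q) → M (τ r) ≡ M r
        at (yes refl) _ = trans (cong M (proj₁ (transpose-Swap p q))) (sym Mp≡Mq)
        at (no _) (yes refl) = trans (cong M (proj₁ (proj₂ (transpose-Swap p q)))) Mp≡Mq
        at (no r≢p) (no r≢q) = cong M (proj₂ (proj₂ (transpose-Swap p q)) r r≢p r≢q)
      τ-inj : Inj τ
      τ-inj r r′ eq = trans (sym (transpose-inverse q p)) (trans (cong (transpose q p) eq) (transpose-inverse q p))

    rowWise : (Fin n → Fin n → Fin n) → Idx
    rowWise J p = J (qt p) (rm p)

    columnWise : (Fin n → Fin n → Fin n) → Idx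
    columnWise K p = K (rm p) (qt p)

    ∑-rowWise : ∀ h → Cong idx h → ∑ (fun n (maps n n)) (h ∘ rowWise) ≡ ∑ idx h
    ∑-rowWise h hc = ∑-bij (fun n (maps n n)) idx rowWise (λ K a b → K (combine a b))
      (λ J K eq a b → sym (trans (eq (combine a b)) (cong₂ J (quot-combine a b) (rem-combine a b))))
      (λ J K eq p → sym (trans (eq (qt p) (rm p)) (cong K (pair-qt-rm p)))) h hc

    ∑-columnWise : ∀ h → Cong idx h → ∑ (fun n (maps n n)) (h ∘ columnWise) ≡ ∑ idx h
    ∑-columnWise h hc = ∑-bij (fun n (maps n n)) idx columnWise (λ K a b → K (combine b a))
      (λ J K eq a b → sym (trans (eq (combine b a)) (cong₂ J (rem-combine b a) (quot-combine b a))))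
      (λ J K eq p → sym (trans (eq (rm p) (qt p)) (cong K (pair-qt-rm p)))) h hc

    W-rowWise : ∀ J → W qt (rowWise J) ≡ ∏ (λ a → E (J a))
    W-rowWise J = E-blocks n _ J (λ a b → cong₂ (combine {n} {n}) (quot-combine a b)
      (cong₂ J (quot-combine a b) (rem-combine a b)))

    -- Conjugation by `flipIdx` turns columns into consecutive blocks, at the cost of `flipSign`
    -- squared, which is 1.
    W-columnWise : ∀ K → W (columnWise K) rm ≡ columnSigns K
    W-columnWise K = begin
      E v
        ≡⟨ *-identityˡ _ ⟨
      1ℤ * E v
        ≡⟨ cong (_* E v) (sym flipSign²) ⟩
      flipSign * flipSign * E v
        ≡⟨ trans (*-assoc flipSign flipSign (E v)) (cong (flipSign *_) (*-comm _ _)) ⟩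
      flipSign * (E v * flipSign)
        ≡⟨ cong (flipSign *_) (sym (E-∘ flipIdx v)) ⟩
      flipSign * E (flipIdx ∘ v)
        ≡⟨ E-∘ (flipIdx ∘ v) flipIdx ⟨
      E (flipIdx ∘ v ∘ flipIdx)
        ≡⟨ E-blocks n _ K (λ c a → trans (cong (flipIdx ∘ v) (flipIdx-combine c a))
             (trans (flipIdx-combine _ _) (cong₂ (combine {n} {n}) (rem-combine a c)
               (cong₂ K (rem-combine a c) (quot-combine a c))))) ⟩
      columnSigns K ∎
      where
      v : Fin N → Fin N
      v = pair (columnWise K) rm

    ∏-*-sq : ∀ (σ : Fin n → Fin n → Fin n) → ∏-sq σ ≡ ∏ (λ a → E (σ a)) * ∏ (λ a → E (σ a))
    ∏-*-sq σ = ∏-* (λ a → E (σ a)) (λ a → E (σ a))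

    -- A nonzero `W qt J` means that `J` permutes each row, and a nonzero `W K rm` that `K` permutes
    -- each column. After `align` the remaining factor is the product of column signs of the word
    -- shuffled within its rows.
    Z-symmetrizer : Z qt rm ≡ symmetrizer n n transposedSigns
    Z-symmetrizer = begin
      ∑ idx (λ J → ∑ idx (λ K → W qt J * (W K J * W K rm)))
        ≡⟨ ∑-cong idx (λ J → trans (∑-*ˡ idx (W qt J) _) (align J)) ⟩
      ∑ idx (λ J → W qt J * W qt J * ∑ idx (λ K → W K rm * W (K ∘ pair qt J) rm))
        ≡⟨ ∑-rowWise _ (λ eq → cong₂ _*_ (cong₂ _*_ (W-cong (λ _ → refl) eq) (W-cong (λ _ → refl) eq))
             (∑-cong idx (λ K → cong (W K rm *_) (W-cong (λ p → cong K (cong (combine {n} {n} (qt p)) (eq p))) (λ _ → refl))))) ⟨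
      ∑ (fun n (maps n n)) (λ σ → W qt (rowWise σ) * W qt (rowWise σ) * ∑ idx (λ K → W K rm * W (K ∘ pair qt (rowWise σ)) rm))
        ≡⟨ ∑-cong (fun n (maps n n)) (λ σ → cong₂ _*_
             (trans (cong₂ _*_ (W-rowWise σ) (W-rowWise σ)) (sym (∏-*-sq σ)))
             (trans (sym (∑-columnWise _ (λ eq → cong₂ _*_ (W-cong eq (λ _ → refl)) (W-cong (λ p → eq _) (λ _ → refl)))))
               (∑-cong (fun n (maps n n)) (λ K → cong₂ _*_ (W-columnWise K) (trans
                 (W-cong (λ p → cong₂ K (rem-combine (qt p) (rowWise σ p)) (quot-combine (qt p) (rowWise σ p))) (λ _ → refl))
                 (W-columnWise (λ c a → shuffle K σ a c))))))) ⟩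
      symmetrizer n n transposedSigns ∎
      where
      -- Replacing `K` by `K ∘ v` turns `W K J` into `E v * W K rm`, because `J` is `rm ∘ v`. The
      -- sign given off squares the weight `W qt J`, which is `E v`.
      align : ∀ J → W qt J * ∑ idx (λ K → W K J * W K rm)
                  ≡ W qt J * W qt J * ∑ idx (λ K → W K rm * W (K ∘ pair qt J) rm)
      align J = trans (E-weight v (λ inj → begin
        ∑ idx (λ K → W K J * W K rm)
          ≡⟨ ∑-∘ (fin n) v inj (λ K → W K J * W K rm) (λ eq → cong₂ _*_ (W-cong eq (λ _ → refl)) (W-cong eq (λ _ → refl))) ⟨
        ∑ idx (λ K → W (K ∘ v) J * W (K ∘ v) rm)
          ≡⟨ ∑-cong idx (λ K → trans (cong (_* W (K ∘ v) rm) (trans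
               (W-cong (λ _ → refl) (λ p → sym (rem-combine (qt p) (J p)))) (W-∘ K rm v)))
               (*-assoc (E v) (W K rm) (W (K ∘ v) rm))) ⟩
        ∑ idx (λ K → E v * (W K rm * W (K ∘ v) rm))
          ≡⟨ ∑-*ˡ idx (E v) _ ⟩
        E v * ∑ idx (λ K → W K rm * W (K ∘ v) rm) ∎)) (sym (*-assoc (E v) (E v) _))
        where
        v : Fin N → Fin N
        v = pair qt J

    -- Every column of `base` is the identity, so the power of the determinant equals 1 there and
    -- only the hook lengths remain.
    Z-value : Z qt rm ≡ ι (hooks n n)
    Z-value = trans Z-symmetrizer (trans
      (symmetrizer-invariant n n transposedSigns (λ eq → ∏-cong (λ c → E-cong (λ a → eq a c))) (transposedSigns-invariant n n))
      (trans (cong (ι (hooks n n) *_) (∏-one n (λ _ → E-id n))) (*-identityʳ _)))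

    -- Powers of `W`. The identity matrix is written as a product over places because the delta
    -- factors closing the tensor come in this form.
    Wpow : ℕ → Idx → Idx → ℤ
    Wpow zero    J I = ∏ (λ p → ⟦ I p ≟ J p ⟧)
    Wpow (suc m) J I = ∑ idx (λ K → W J K * Wpow m K I)

    κ : ℤ
    κ = flipSign * ι (hooks n n)

    ∏-⟦⟧ : ∀ {m} (I J : Fin m → Fin n) → ∏ (λ p → ⟦ I p ≟ J p ⟧) ≡ ⟦ eq? (maps m n) J I ⟧
    ∏-⟦⟧ {zero}  I J = refl
    ∏-⟦⟧ {suc m} I J = begin
      ⟦ I zero ≟ J zero ⟧ * ∏ (λ p → ⟦ I (suc p) ≟ J (suc p) ⟧)
        ≡⟨ ⟦⟧-cong (I zero ≟ J zero) (J zero ≟ I zero) sym sym (λ _ → ∏-⟦⟧ (I ∘ suc) (J ∘ suc)) ⟩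
      ⟦ J zero ≟ I zero ⟧ * ⟦ eq? (maps m n) (J ∘ suc) (I ∘ suc) ⟧
        ≡⟨ cong (⟦ J zero ≟ I zero ⟧ *_) (sym (*-identityʳ _)) ⟩
      ⟦ J zero ≟ I zero ⟧ * (⟦ eq? (maps m n) (J ∘ suc) (I ∘ suc) ⟧ * 1ℤ)
        ≡⟨ trans (sym (⟦⟧-× (J zero ≟ I zero) (eq? (maps m n) (J ∘ suc) (I ∘ suc)) 1ℤ)) (*-identityʳ _) ⟩
      ⟦ eq? (maps (suc m) n) J I ⟧ ∎

    Wpow-1 : ∀ J I → Wpow 1 J I ≡ W J I
    Wpow-1 J I = trans (∑-cong idx (λ K → trans (*-comm _ _) (cong (_* W J K) (∏-⟦⟧ I K))))
      (∑-pick idx (λ K → W J K) (λ eq → W-cong (λ _ → refl) eq) I)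

    Wpow-3 : ∀ J I → Wpow 3 J I ≡ κ * W J I
    Wpow-3 J I = begin
      ∑ idx (λ K → W J K * ∑ idx (λ L → W K L * Wpow 1 L I))
        ≡⟨ ∑-cong idx (λ K → trans (cong (W J K *_) (∑-cong idx (λ L → trans
             (cong₂ _*_ (W-flip L K) (Wpow-1 L I)) (*-assoc flipSign _ _)))) (trans (sym (∑-*ˡ idx (W J K) _))
             (∑-cong idx (λ L → *-swap (W J K) flipSign _)))) ⟩
      ∑ idx (λ K → ∑ idx (λ L → flipSign * (W J K * (W L K * W L I))))
        ≡⟨ trans (∑-cong idx (λ K → ∑-*ˡ idx flipSign _)) (∑-*ˡ idx flipSign _) ⟩
      flipSign * Z J I
        ≡⟨ cong (flipSign *_) (trans (Z≡cW J I) (cong (_* W J I) Z-value)) ⟩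
      flipSign * (ι (hooks n n) * W J I)
        ≡⟨ *-assoc flipSign _ _ ⟨
      κ * W J I ∎

    Wpow-shift : ∀ m J I → Wpow (suc (suc (suc m))) J I ≡ κ * Wpow (suc m) J I
    Wpow-shift zero    J I = trans (Wpow-3 J I) (cong (κ *_) (sym (Wpow-1 J I)))
    Wpow-shift (suc m) J I = trans (∑-cong idx (λ K → trans (cong (W J K *_) (Wpow-shift m K I))
      (*-swap (W J K) κ (Wpow (suc m) K I)))) (∑-*ˡ idx κ _)

    -- The trace of `W` to the power `m + 1`. The factor written out belongs to the first mode of
    -- the tensor, which is treated apart from the others.
    trace : ℕ → ℤ
    trace m = ∑ idx (λ I → ∑ idx (λ J → W I J * Wpow m J I))

    -- A map into the square is a pair of words, and its sign is the entry of `W` at that pair.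
    ∑-pair : ∀ (h : Idx → Idx → ℤ) → (∀ {I I′ J J′} → (∀ p → I p ≡ I′ p) → (∀ p → J p ≡ J′ p) → h I J ≡ h I′ J′) →
      ∑ (maps N N) (λ v → E v * h (qt ∘ v) (rm ∘ v)) ≡ ∑ idx (λ I → ∑ idx (λ J → W I J * h I J))
    ∑-pair h hc = begin
      ∑ (maps N N) (λ v → E v * h (qt ∘ v) (rm ∘ v))
        ≡⟨ ∑-bij (idx ⊗ idx) (maps N N) (λ (I , J) → pair I J) (λ v → qt ∘ v , rm ∘ v)
             (λ (I , J) v eq → (λ p → sym (trans (cong qt (eq p)) (quot-combine (I p) (J p))))
                             , (λ p → sym (trans (cong rm (eq p)) (rem-combine (I p) (J p)))))
             (λ (I , J) v (p , q) r → trans (sym (pair-qt-rm (v r))) (cong₂ (combine {n} {n}) (sym (p r)) (sym (q r))))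
             _ (λ eq → cong₂ _*_ (E-cong eq) (hc (cong qt ∘ eq) (cong rm ∘ eq))) ⟨
      ∑ (idx ⊗ idx) (λ (I , J) → W I J * h (qt ∘ pair I J) (rm ∘ pair I J))
        ≡⟨ trans (∑-⊗ idx idx _) (∑-cong idx (λ I → ∑-cong idx (λ J → cong (W I J *_)
             (hc (λ p → quot-combine (I p) (J p)) (λ p → rem-combine (I p) (J p)))))) ⟩
      ∑ idx (λ I → ∑ idx (λ J → W I J * h I J)) ∎

    ∑∑-W² : ∑ idx (λ I → ∑ idx (λ J → W I J * W I J)) ≡ ι (N !)
    ∑∑-W² = trans (sym (∑-pair W W-cong)) (trans
      (∑-cong (maps N N) (λ v → cong (E v *_) (E-cong (λ p → pair-qt-rm (v p))))) (∑-sq N))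

    trace-1 : trace 1 ≡ flipSign * ι (N !)
    trace-1 = begin
      ∑ idx (λ I → ∑ idx (λ J → W I J * Wpow 1 J I))
        ≡⟨ ∑-cong idx (λ I → trans (∑-cong idx (λ J → trans
             (cong (W I J *_) (trans (Wpow-1 J I) (W-flip I J))) (*-swap (W I J) flipSign (W I J))))
             (∑-*ˡ idx flipSign _)) ⟩
      ∑ idx (λ I → flipSign * ∑ idx (λ J → W I J * W I J))
        ≡⟨ trans (∑-*ˡ idx flipSign _) (cong (flipSign *_) ∑∑-W²) ⟩
      flipSign * ι (N !) ∎

    trace-shift : ∀ m → trace (suc (suc (suc m))) ≡ κ * trace (suc m)
    trace-shift m = trans (∑-cong idx (λ I → trans (∑-cong idx (λ J → trans
        (cong (W I J *_) (Wpow-shift m J I)) (*-swap (W I J) κ _))) (∑-*ˡ idx κ _))) (∑-*ˡ idx κ _)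

  -- The hyperdeterminant as a trace

  prodₗ : List ℤ → ℤ
  prodₗ = List.foldr _*_ 1ℤ

  opaque
    unfolding _+_ ∑

    sumℤ-map : ∀ (xs : List A) (f : A → ℤ) → sumℤ (List.map f xs) ≡ Σₗ xs f
    sumℤ-map xs f = refl

    prodℤ≡prodₗ : ∀ xs → prodℤ xs ≡ prodₗ xs
    prodℤ≡prodₗ xs = refl

    ℤ-*≡* : ∀ x y → x ℤ.* y ≡ x * y
    ℤ-*≡* x y = refl

    ℤ-neg≡- : ∀ x → ℤ.- x ≡ - x
    ℤ-neg≡- x = refl

    ι-def : ∀ k → ι k ≡ ℤ.+ k
    ι-def k = refl

    ∑-allFin : ∀ n (f : Fin n → ℤ) → Σₗ (allFin n) f ≡ ∑ (fin n) f
    ∑-allFin n f = refl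

    unit-sign : ∀ x → x * x ≡ 1ℤ → x ≡ 1ℤ ⊎ x ≡ - 1ℤ
    unit-sign (ℤ.+ k) eq with refl ← ℕₚ.m*n≡1⇒m≡1 k k (ℤₚ.+-injective (trans (ℤₚ.pos-* k k) eq)) = inj₁ refl
    unit-sign ℤ.-[1+ k ] eq with refl ← ℕₚ.suc-injective (ℕₚ.m*n≡1⇒m≡1 (suc k) (suc k) (ℤₚ.+-injective eq)) = inj₂ refl

  δ≡⟦⟧ : ∀ (a b : Fin n) → δ a b ≡ ⟦ a ≟ b ⟧
  δ≡⟦⟧ a b with a ≟ b
  ... | yes _ = refl
  ... | no _  = refl

  Σₗ-filter : ∀ (p : A → Bool) xs (f : A → ℤ) →
              Σₗ (filterᵇ p xs) f ≡ Σₗ xs (λ x → (if p x then 1ℤ else 0ℤ) * f x)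
  Σₗ-filter p []       f = refl
  Σₗ-filter p (x ∷ xs) f with p x
  ... | true  = cong₂ _+_ (sym (*-identityˡ (f x))) (Σₗ-filter p xs f)
  ... | false = trans (Σₗ-filter p xs f) (sym (trans (cong₂ _+_ (zeroˡ (f x)) refl) (+-identityˡ _)))

  prodₗ-filter : ∀ (p : A → Bool) xs (f : A → ℤ) →
                 prodₗ (List.map f (filterᵇ p xs)) ≡ prodₗ (List.map (λ x → if p x then f x else 1ℤ) xs)
  prodₗ-filter p []       f = refl
  prodₗ-filter p (x ∷ xs) f with p x
  ... | true  = cong (f x *_) (prodₗ-filter p xs f)
  ... | false = trans (prodₗ-filter p xs f) (sym (*-identityˡ _))

  prodₗ-++ : ∀ xs ys → prodₗ (xs List.++ ys) ≡ prodₗ xs * prodₗ ys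
  prodₗ-++ []       ys = sym (*-identityˡ _)
  prodₗ-++ (x ∷ xs) ys = trans (cong (x *_) (prodₗ-++ xs ys)) (sym (*-assoc x _ _))

  prodₗ-allFin : ∀ n (f : Fin n → ℤ) → prodₗ (List.map f (allFin n)) ≡ ∏ f
  prodₗ-allFin n f = trans (cong prodₗ (map-tabulate id f)) (tab n f)
    where
    tab : ∀ n (f : Fin n → ℤ) → prodₗ (List.tabulate f) ≡ ∏ f
    tab zero    f = refl
    tab (suc n) f = cong (f zero *_) (tab n (f ∘ suc))

  prodₗ-× : ∀ (xs : List A) (ys : List B) (f : A × B → ℤ) →
    prodₗ (List.map f (List.cartesianProduct xs ys)) ≡
    prodₗ (List.map (λ x → prodₗ (List.map (λ y → f (x , y)) ys)) xs)
  prodₗ-× []       ys f = refl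
  prodₗ-× (x ∷ xs) ys f = trans (cong prodₗ (map-++ f (List.map (x ,_) ys) _))
    (trans (prodₗ-++ (List.map f (List.map (x ,_) ys)) _)
      (cong₂ _*_ (cong prodₗ (sym (map-∘ ys))) (prodₗ-× xs ys f)))

  up-<ᶠ : ∀ (p q : Fin m) x → (if p <ᶠ q then x else 1ℤ) ≡ up p q x
  up-<ᶠ zero    zero    x = refl
  up-<ᶠ zero    (suc q) x = refl
  up-<ᶠ (suc p) zero    x = refl
  up-<ᶠ (suc p) (suc q) x = up-<ᶠ p q x

  E-orderedPairs : ∀ (v : Fin m → Fin n) →
    E v ≡ prodₗ (List.map (λ (p , q) → sg (v p) (v q)) (orderedPairs m))
  E-orderedPairs {m} v = sym (begin
    prodₗ (List.map (λ (p , q) → sg (v p) (v q)) (orderedPairs m))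
      ≡⟨ prodₗ-filter (λ p → proj₁ p <ᶠ proj₂ p) (List.cartesianProduct (allFin m) (allFin m)) _ ⟩
    prodₗ (List.map (λ (p , q) → if p <ᶠ q then sg (v p) (v q) else 1ℤ) (List.cartesianProduct (allFin m) (allFin m)))
      ≡⟨ prodₗ-× (allFin m) (allFin m) _ ⟩
    prodₗ (List.map (λ p → prodₗ (List.map (λ q → if p <ᶠ q then sg (v p) (v q) else 1ℤ) (allFin m))) (allFin m))
      ≡⟨ trans (prodₗ-allFin m _) (∏-cong (λ p → trans (prodₗ-allFin m _) (∏-cong (λ q → up-<ᶠ p q (sg (v p) (v q)))))) ⟩
    ∏∏ (λ p q → up p q (sg (v p) (v q)))
      ≡⟨ E-∏∏ v ⟨
    E v ∎)

  sg-cases : ∀ (x y : Fin n) → sg x y ≡ (if not (does (x ≟ y)) then (if y <ᶠ x then - 1ℤ else 1ℤ) else 0ℤ)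
  sg-cases zero    zero    = refl
  sg-cases zero    (suc y) = refl
  sg-cases (suc x) zero    = refl
  sg-cases (suc x) (suc y) = sg-cases x y

  signₗ : ℕ → ℤ
  signₗ k = (ℤ.- (ℤ.+ 1)) ℤ.^ k

  -- Along any list of pairs, a pair of equal values kills the product and the injectivity test
  -- alike, and a pair in the wrong order contributes -1 to both sides.
  sgn-pairs : ∀ (v : Fin m → Fin n) (ps : List (Fin m × Fin m)) →
    prodₗ (List.map (λ (p , q) → sg (v p) (v q)) ps) ≡
    (if List.foldr _∧_ true (List.map (λ p → not (does (v (proj₁ p) ≟ v (proj₂ p)))) ps) then 1ℤ else 0ℤ)
      * signₗ (length (filterᵇ (λ p → v (proj₂ p) <ᶠ v (proj₁ p)) ps))
  sgn-pairs v [] = sym (*-identityˡ 1ℤ)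
  sgn-pairs v ((p , q) ∷ ps)
    rewrite sg-cases (v p) (v q) | sgn-pairs v ps
    with not (does (v p ≟ v q)) | v q <ᶠ v p
  ... | false | _     = trans (zeroˡ _) (sym (zeroˡ _))
  ... | true  | false = *-identityˡ _
  ... | true  | true  = trans (*-swap (- 1ℤ) _ _) (cong₂ _*_ refl
          (trans (cong (_* rest) (sym (ℤ-neg≡- 1ℤ))) (sym (ℤ-*≡* (ℤ.- 1ℤ) rest))))
    where rest = signₗ (length (filterᵇ (λ p → v (proj₂ p) <ᶠ v (proj₁ p)) ps))

  sgn≡E : ∀ {N} (v : Vec (Fin N) N) → (if isInjective v then 1ℤ else 0ℤ) * sgn v ≡ E (lookup v)
  sgn≡E {N} v = sym (trans (E-orderedPairs (lookup v)) (sgn-pairs (lookup v) (orderedPairs N)))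

  Σₗ-allVecs : ∀ k m (h : (Fin m → Fin k) → ℤ) → Cong (maps m k) h →
               Σₗ (allVecs k m) (h ∘ lookup) ≡ ∑ (maps m k) h
  Σₗ-allVecs k zero    h hc = trans (+-identityʳ _) (trans (hc λ ()) (sym (∑-fun₀ (fin k) h)))
  Σₗ-allVecs k (suc m) h hc = begin
    Σₗ (allVecs k (suc m)) (h ∘ lookup)
      ≡⟨ Σₗ-concatMap _ (allFin k) _ ⟩
    Σₗ (allFin k) (λ x → Σₗ (List.map (x Vec.∷_) (allVecs k m)) (h ∘ lookup))
      ≡⟨ Σₗ-cong (allFin k) (λ x → trans (Σₗ-map (x Vec.∷_) (allVecs k m) _)
           (trans (Σₗ-cong (allVecs k m) (λ v → hc λ { zero → refl ; (suc i) → refl }))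
                  (Σₗ-allVecs k m (λ v → h (x F.∷ v)) (λ eq → hc (∷-cong refl eq))))) ⟩
    Σₗ (allFin k) (λ x → ∑ (maps m k) (λ v → h (x F.∷ v)))
      ≡⟨ ∑-allFin k _ ⟩
    ∑ (fin k) (λ x → ∑ (maps m k) (λ v → h (x F.∷ v)))
      ≡⟨ ∑-fun (fin k) h ⟨
    ∑ (maps (suc m) k) h ∎

  Σₗ-SymList : ∀ N (h : (Fin N → Fin N) → ℤ) → Cong (maps N N) h →
               Σₗ (SymList N) (λ σ → sgn σ * h (lookup σ)) ≡ ∑ (maps N N) (λ v → E v * h v)
  Σₗ-SymList N h hc = begin
    Σₗ (SymList N) (λ σ → sgn σ * h (lookup σ))
      ≡⟨ Σₗ-filter isInjective (allVecs N N) _ ⟩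
    Σₗ (allVecs N N) (λ σ → (if isInjective σ then 1ℤ else 0ℤ) * (sgn σ * h (lookup σ)))
      ≡⟨ Σₗ-cong (allVecs N N) (λ σ → trans (sym (*-assoc _ (sgn σ) _)) (cong (_* h (lookup σ)) (sgn≡E σ))) ⟩
    Σₗ (allVecs N N) (λ σ → E (lookup σ) * h (lookup σ))
      ≡⟨ Σₗ-allVecs N N (λ v → E v * h v) (λ eq → cong₂ _*_ (E-cong eq) (hc eq)) ⟩
    ∑ (maps N N) (λ v → E v * h v) ∎

  module Trace (n : ℕ) where
    open Square n

    entry : ∀ {d} → Vec (Vec (Fin N) N) d → Fin N → Vec (Fin n × Fin n) d
    entry σs k = Vec.map (remQuot {n} n) (Vec.map (λ σ → lookup σ k) σs)

    -- A chain of deltas that enters at `j`, runs through the modes `ps` and closes up at `i`: an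
    -- entry of the tensor with its first mode `(i , j)` split off.
    cyc : ∀ {d} → Fin n → Fin n → Vec (Fin n × Fin n) d → ℤ
    cyc j i ps = chainδ j ps * δ i (lastJ j ps)

    Mpairs-∷ : ∀ {d} p (ps : Vec (Fin n × Fin n) d) → Mpairs (identity n) (p Vec.∷ ps) ≡ cyc (proj₂ p) (proj₁ p) ps
    Mpairs-∷ (i , j) ps = ℤ-*≡* (chainδ j ps) (δ i (lastJ j ps))

    cyc-∷ : ∀ {d} j i p (ps : Vec (Fin n × Fin n) d) → cyc j i (p Vec.∷ ps) ≡ δ j (proj₁ p) * cyc (proj₂ p) i ps
    cyc-∷ j i (i′ , j′) ps = trans (cong (_* δ i (lastJ j′ ps)) (ℤ-*≡* (δ j i′) (chainδ j′ ps)))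
      (*-assoc (δ j i′) (chainδ j′ ps) (δ i (lastJ j′ ps)))

    signs : ∀ {d} → Vec (Vec (Fin N) N) d → ℤ
    signs σs = prodₗ (Vec.toList (Vec.map sgn σs))

    chains : ∀ d → Idx → Idx → ℤ
    chains d J I = Σₗ (tuples (SymList N) d) (λ σs → signs σs * ∏ (λ k → cyc (J k) (I k) (entry σs k)))

    Wpow-cong : ∀ m {J J′ I I′} → (∀ p → J p ≡ J′ p) → (∀ p → I p ≡ I′ p) → Wpow m J I ≡ Wpow m J′ I′
    Wpow-cong zero    p q = ∏-cong (λ r → cong₂ (λ i j → ⟦ i ≟ j ⟧) (q r) (p r))
    Wpow-cong (suc m) p q = ∑-cong idx (λ K → cong₂ _*_ (W-cong p (λ _ → refl)) (Wpow-cong m (λ _ → refl) q))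

    -- A further mode is a permutation of the square, that is, a pair of words `I′`, `K` weighted by
    -- `W I′ K`. Its deltas over all places force `I′ = J`, and the chain goes on from `K`; so each
    -- mode amounts to one multiplication by `W`.
    chains≡Wpow : ∀ d J I → chains d J I ≡ Wpow d J I
    chains≡Wpow zero J I = trans (+-identityʳ _) (trans (*-identityˡ _)
      (∏-cong (λ k → trans (*-identityˡ _) (δ≡⟦⟧ (I k) (J k)))))
    chains≡Wpow (suc d) J I = begin
      chains (suc d) J I
        ≡⟨ Σₗ-concatMap _ (SymList N) _ ⟩
      Σₗ (SymList N) (λ σ → Σₗ (List.map (σ Vec.∷_) (tuples (SymList N) d)) _)
        ≡⟨ Σₗ-cong (SymList N) (λ σ → trans (Σₗ-map (σ Vec.∷_) (tuples (SymList N) d) _)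
             (trans (Σₗ-cong (tuples (SymList N) d) (λ σs → trans
               (cong (sgn σ * signs σs *_) (trans
                 (∏-cong (λ k → cyc-∷ (J k) (I k) (remQuot {n} n (lookup σ k)) (entry σs k)))
                 (∏-* (λ k → δ (J k) (qt (lookup σ k))) _)))
               (trans (*-assoc (sgn σ) (signs σs) _) (cong (sgn σ *_) (*-swap (signs σs) _ _)))))
             (trans (Σₗ-*ˡ (tuples (SymList N) d) (sgn σ) _) (cong (sgn σ *_)
               (trans (Σₗ-*ˡ (tuples (SymList N) d) (∏ (λ k → δ (J k) (qt (lookup σ k)))) _)
                 (cong₂ _*_ (∏-cong (λ k → δ≡⟦⟧ (J k) _)) (chains≡Wpow d (rm ∘ lookup σ) I))))))) ⟩
      Σₗ (SymList N) (λ σ → sgn σ * step (qt ∘ lookup σ) (rm ∘ lookup σ))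
        ≡⟨ Σₗ-SymList N (λ v → step (qt ∘ v) (rm ∘ v)) (λ eq → step-cong (cong qt ∘ eq) (cong rm ∘ eq)) ⟩
      ∑ (maps N N) (λ v → E v * step (qt ∘ v) (rm ∘ v))
        ≡⟨ ∑-pair step step-cong ⟩
      ∑ idx (λ I′ → ∑ idx (λ K → W I′ K * step I′ K))
        ≡⟨ ∑-cong idx (λ I′ → trans (∑-cong idx (λ K → trans (*-swap (W I′ K) _ _)
             (cong (_* (W I′ K * Wpow d K I)) (∏-⟦⟧ J I′)))) (∑-*ˡ idx ⟦ eq? idx I′ J ⟧ _)) ⟩
      ∑ idx (λ I′ → ⟦ eq? idx I′ J ⟧ * ∑ idx (λ K → W I′ K * Wpow d K I))
        ≡⟨ ∑-pick idx _ (λ eq → ∑-cong idx (λ K → cong (_* Wpow d K I) (W-cong eq (λ _ → refl)))) J ⟩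
      Wpow (suc d) J I ∎
      where
      step : Idx → Idx → ℤ
      step I′ K = ∏ (λ k → ⟦ J k ≟ I′ k ⟧) * Wpow d K I
      step-cong : ∀ {I I′ J J′} → (∀ p → I p ≡ I′ p) → (∀ p → J p ≡ J′ p) → step I J ≡ step I′ J′
      step-cong p q = cong₂ _*_ (∏-cong (λ k → cong (λ i → ⟦ J k ≟ i ⟧) (p k))) (Wpow-cong d q (λ _ → refl))

    hypersum : ∀ d → sumℤ (List.map (λ σs → prodℤ (Vec.toList (Vec.map sgn σs))
                  ℤ.* prodℤ (List.map (λ i → Mn d n (Vec.map (λ σ → lookup σ i) σs)) (allFin N))) (tuples (SymList N) d))
               ≡ Σₗ (tuples (SymList N) d) (λ σs → signs σs * ∏ (λ k → Mpairs (identity n) (entry σs k)))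
    hypersum d = trans (sumℤ-map (tuples (SymList N) d) _) (Σₗ-cong (tuples (SymList N) d) (λ σs →
      trans (ℤ-*≡* (prodℤ (Vec.toList (Vec.map sgn σs))) (prodℤ (List.map (entries σs) (allFin N))))
        (cong₂ _*_ (prodℤ≡prodₗ (Vec.toList (Vec.map sgn σs)))
          (trans (prodℤ≡prodₗ (List.map (entries σs) (allFin N))) (prodₗ-allFin N (entries σs))))))

      where
      entries : Vec (Vec (Fin N) N) d → Fin N → ℤ
      entries σs k = Mpairs (identity n) (entry σs k)

    -- The first mode supplies the words `I` and `J`; the other `d` modes form a chain from `J` back
    -- to `I`.
    hypersum≡trace : ∀ d → Σₗ (tuples (SymList N) (suc d)) (λ σs → signs σs * ∏ (λ k → Mpairs (identity n) (entry σs k)))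
                         ≡ trace d
    hypersum≡trace d = begin
      Σₗ (tuples (SymList N) (suc d)) (λ σs → signs σs * ∏ (λ k → Mpairs (identity n) (entry σs k)))
        ≡⟨ Σₗ-concatMap _ (SymList N) _ ⟩
      Σₗ (SymList N) (λ σ → Σₗ (List.map (σ Vec.∷_) (tuples (SymList N) d)) _)
        ≡⟨ Σₗ-cong (SymList N) (λ σ → trans (Σₗ-map (σ Vec.∷_) (tuples (SymList N) d) _)
             (trans (Σₗ-cong (tuples (SymList N) d) (λ σs → trans
               (*-assoc (sgn σ) (signs σs) _)
               (cong (λ x → sgn σ * (signs σs * x)) (∏-cong (λ k → Mpairs-∷ (remQuot {n} n (lookup σ k)) (entry σs k))))))
             (trans (Σₗ-*ˡ (tuples (SymList N) d) (sgn σ) _)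
               (cong (sgn σ *_) (chains≡Wpow d (rm ∘ lookup σ) (qt ∘ lookup σ)))))) ⟩
      Σₗ (SymList N) (λ σ → sgn σ * Wpow d (rm ∘ lookup σ) (qt ∘ lookup σ))
        ≡⟨ Σₗ-SymList N (λ v → Wpow d (rm ∘ v) (qt ∘ v)) (λ eq → Wpow-cong d (cong rm ∘ eq) (cong qt ∘ eq)) ⟩
      ∑ (maps N N) (λ v → E v * Wpow d (rm ∘ v) (qt ∘ v))
        ≡⟨ ∑-pair (λ I J → Wpow d J I) (λ p q → Wpow-cong d q p) ⟩
      trace d ∎

    hyperdet≡trace : ∀ d → hyperdet (suc d) N (Mn (suc d) n) ≡ ℚ._/_ (trace d) (N !) {{N !≢0}}
    hyperdet≡trace d = cong (λ x → ℚ._/_ x (N !) {{N !≢0}}) (trans (hypersum (suc d)) (hypersum≡trace d))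

    flipSign-unit : flipSign ≡ 1ℤ ⊎ flipSign ≡ - 1ℤ
    flipSign-unit = unit-sign flipSign flipSign²

    -- This is the case of `2 k + 2` modes. It starts from the trace of `W` squared, which is ±
    -- `N !`, and each further pair of modes multiplies by `κ`, which is ± `hooks n n`.
    trace-odd : ∀ k → let t = trace (suc (k ℕ.* 2)); u = ι (hooks n n ℕ.^ k) * ι (N !) in t ≡ u ⊎ t ≡ - u
    trace-odd zero with flipSign-unit
    ... | inj₁ eq = inj₁ (trans trace-1 (cong (_* ι (N !)) (trans eq (sym ι-1))))
    ... | inj₂ eq = inj₂ (trans trace-1 (trans (cong (_* ι (N !)) eq)
                      (trans (sym (-‿distribˡ-* 1ℤ _)) (cong (λ x → - (x * ι (N !))) (sym ι-1)))))
    trace-odd (suc k) = combineSigns flipSign-unit (trace-odd k)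
      where
      h = hooks n n
      u = ι (h ℕ.^ k) * ι (N !)
      h*u : ι h * u ≡ ι (h ℕ.^ suc k) * ι (N !)
      h*u = trans (sym (*-assoc (ι h) _ _)) (cong (_* ι (N !)) (sym (ι-* h (h ℕ.^ k))))
      t = trace (suc (suc k ℕ.* 2))
      u′ = ι (h ℕ.^ suc k) * ι (N !)
      shift : ∀ {x y} → flipSign ≡ x → trace (suc (k ℕ.* 2)) ≡ y → t ≡ x * (ι h * y)
      shift refl refl = trans (trace-shift (k ℕ.* 2)) (*-assoc flipSign (ι h) _)
      combineSigns : (flipSign ≡ 1ℤ ⊎ flipSign ≡ - 1ℤ) → (trace (suc (k ℕ.* 2)) ≡ u ⊎ trace (suc (k ℕ.* 2)) ≡ - u) →
                     t ≡ u′ ⊎ t ≡ - u′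
      combineSigns (inj₁ s) (inj₁ r) = inj₁ (trans (shift s r) (trans (*-identityˡ _) h*u))
      combineSigns (inj₁ s) (inj₂ r) = inj₂ (trans (shift s r) (trans (*-identityˡ _)
        (trans (sym (-‿distribʳ-* (ι h) u)) (cong -_ h*u))))
      combineSigns (inj₂ s) (inj₁ r) = inj₂ (trans (shift s r) (trans (-1*x≈-x _) (cong -_ h*u)))
      combineSigns (inj₂ s) (inj₂ r) = inj₁ (trans (shift s r) (trans (-1*x≈-x _)
        (trans (-‿distribʳ-* (ι h) (- u)) (trans (cong (ι h *_) (-‿involutive u)) h*u))))

  -- Passage to the rational numbers

  *-/-cancel : ∀ x k .{{_ : ℕ.NonZero k}} → (x ℤ.* ℤ.+ k) ℚ./ k ≡ x ℚ./ 1
  *-/-cancel x (suc k) = ℚₚ.fromℚᵘ-cong {mkℚᵘ (x ℤ.* ℤ.+ suc k) k} {mkℚᵘ x 0} (*≡* (ℤₚ.*-identityʳ _))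

  -/1 : ∀ x → (ℤ.- x) ℚ./ 1 ≡ ℚ.- (x ℚ./ 1)
  -/1 x = ℚₚ.toℚᵘ-injective (ℚᵘₚ.≃-trans (ℚₚ.toℚᵘ-fromℚᵘ (mkℚᵘ (ℤ.- x) 0)) (ℚᵘₚ.≃-sym
    (ℚᵘₚ.≃-trans (ℚₚ.toℚᵘ-homo‿- (x ℚ./ 1)) (ℚᵘₚ.-‿cong (ℚₚ.toℚᵘ-fromℚᵘ (mkℚᵘ x 0))))))

  *-/1 : ∀ x y → (x ℤ.* y) ℚ./ 1 ≡ (x ℚ./ 1) ℚ.* (y ℚ./ 1)
  *-/1 x y = ℚₚ.toℚᵘ-injective (ℚᵘₚ.≃-trans (ℚₚ.toℚᵘ-fromℚᵘ (mkℚᵘ (x ℤ.* y) 0)) (ℚᵘₚ.≃-sym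
    (ℚᵘₚ.≃-trans (ℚₚ.toℚᵘ-homo-* (x ℚ./ 1) (y ℚ./ 1))
      (ℚᵘₚ.*-cong (ℚₚ.toℚᵘ-fromℚᵘ (mkℚᵘ x 0)) (ℚₚ.toℚᵘ-fromℚᵘ (mkℚᵘ y 0))))))

  rising-! : ∀ i n → rising (suc i) n ℕ.* i ! ≡ (n ℕ.+ i) !
  rising-! i zero    = ℕₚ.*-identityˡ (i !)
  rising-! i (suc n) = trans (ℕₚ.*-assoc (suc i ℕ.+ n) (rising (suc i) n) (i !))
    (cong₂ ℕ._*_ (cong suc (ℕₚ.+-comm i n)) (rising-! i n))

  prodℚ-∷ʳ : ∀ xs x → prodℚ (xs List.∷ʳ x) ≡ prodℚ xs ℚ.* x
  prodℚ-∷ʳ []       x = ℚₚ.*-comm x ℚ.1ℚ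
  prodℚ-∷ʳ (y ∷ xs) x = trans (cong (y ℚ.*_) (prodℚ-∷ʳ xs x)) (sym (ℚₚ.*-assoc y (prodℚ xs) x))

  -- The number of columns `s` is separated from `n` so that the last factor of the product can be
  -- removed by induction. That factor, (n + s)! / s!, is the integer `rising (suc s) n`.
  hooks≡prodℚ : ∀ n s → prodℚ (List.map (λ i → ℚ._/_ (ℤ.+ ((n ℕ.+ i) !)) (i !) {{i !≢0}}) (List.upTo s)) ≡ (ℤ.+ hooks n s) ℚ./ 1
  hooks≡prodℚ n zero    = refl
  hooks≡prodℚ n (suc s) = begin
    prodℚ (List.map f (List.upTo (suc s)))
      ≡⟨ cong (prodℚ ∘ List.map f) (sym (upTo-∷ʳ s)) ⟩
    prodℚ (List.map f (List.upTo s List.∷ʳ s))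
      ≡⟨ cong prodℚ (map-++ f (List.upTo s) (s ∷ [])) ⟩
    prodℚ (List.map f (List.upTo s) List.∷ʳ f s)
      ≡⟨ prodℚ-∷ʳ (List.map f (List.upTo s)) (f s) ⟩
    prodℚ (List.map f (List.upTo s)) ℚ.* f s
      ≡⟨ cong₂ ℚ._*_ (hooks≡prodℚ n s) (begin
         f s
           ≡⟨ cong (λ x → ℚ._/_ x (s !) {{s !≢0}}) (trans (cong ℤ.+_ (sym (rising-! s n))) (ℤₚ.pos-* (rising (suc s) n) (s !))) ⟩
         ℚ._/_ (ℤ.+ rising (suc s) n ℤ.* ℤ.+ (s !)) (s !) {{s !≢0}}
           ≡⟨ *-/-cancel (ℤ.+ rising (suc s) n) (s !) {{s !≢0}} ⟩
         (ℤ.+ rising (suc s) n) ℚ./ 1 ∎) ⟩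
    ((ℤ.+ hooks n s) ℚ./ 1) ℚ.* ((ℤ.+ rising (suc s) n) ℚ./ 1)
      ≡⟨ *-/1 (ℤ.+ hooks n s) (ℤ.+ rising (suc s) n) ⟨
    (ℤ.+ hooks n s ℤ.* ℤ.+ rising (suc s) n) ℚ./ 1
      ≡⟨ cong (λ x → x ℚ./ 1) (trans (ℤₚ.*-comm (ℤ.+ hooks n s) _) (sym (ℤₚ.pos-* (rising (suc s) n) (hooks n s)))) ⟩
    (ℤ.+ hooks n (suc s)) ℚ./ 1 ∎
    where
    f : ℕ → ℚ
    f i = ℚ._/_ (ℤ.+ ((n ℕ.+ i) !)) (i !) {{i !≢0}}

  powℚ-/1 : ∀ h k → powℚ ((ℤ.+ h) ℚ./ 1) k ≡ (ℤ.+ (h ℕ.^ k)) ℚ./ 1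
  powℚ-/1 h zero    = refl
  powℚ-/1 h (suc k) = trans (cong (((ℤ.+ h) ℚ./ 1) ℚ.*_) (powℚ-/1 h k))
    (trans (sym (*-/1 (ℤ.+ h) (ℤ.+ (h ℕ.^ k)))) (cong (λ x → x ℚ./ 1) (sym (ℤₚ.pos-* h (h ℕ.^ k)))))

  hyperdet-even : ∀ k n → let D = hyperdet (suc (suc (k ℕ.* 2))) (n ℕ.* n) (Mn (suc (suc (k ℕ.* 2))) n) in
    (D ≡ powℚ (hookProd n) k) ⊎ (D ≡ ℚ.- powℚ (hookProd n) k)
  hyperdet-even k n = result (trace-odd k)
    where
    open Square n
    open Trace n
    h = hooks n n
    value : powℚ (hookProd n) k ≡ (ℤ.+ (h ℕ.^ k)) ℚ./ 1
    value = trans (cong (λ x → powℚ x k) (hooks≡prodℚ n n)) (powℚ-/1 h k)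
    quotient-of : ∀ x → ℚ._/_ (x ℤ.* ℤ.+ (N !)) (N !) {{N !≢0}} ≡ x ℚ./ 1
    quotient-of x = *-/-cancel x (N !) {{N !≢0}}
    product : ι (h ℕ.^ k) * ι (N !) ≡ ℤ.+ (h ℕ.^ k) ℤ.* ℤ.+ (N !)
    product = trans (cong₂ _*_ (ι-def _) (ι-def _)) (sym (ℤ-*≡* _ _))
    D = hyperdet (suc (suc (k ℕ.* 2))) (n ℕ.* n) (Mn (suc (suc (k ℕ.* 2))) n)
    u = ι (h ℕ.^ k) * ι (N !)
    result : (trace (suc (k ℕ.* 2)) ≡ u ⊎ trace (suc (k ℕ.* 2)) ≡ - u) →
             (D ≡ powℚ (hookProd n) k) ⊎ (D ≡ ℚ.- powℚ (hookProd n) k)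
    result (inj₁ eq) = inj₁ (trans (hyperdet≡trace (suc (k ℕ.* 2)))
      (trans (cong (λ x → ℚ._/_ x (N !) {{N !≢0}}) (trans eq product))
        (trans (quotient-of (ℤ.+ (h ℕ.^ k))) (sym value))))
    result (inj₂ eq) = inj₂ (trans (hyperdet≡trace (suc (k ℕ.* 2)))
      (trans (cong (λ x → ℚ._/_ x (N !) {{N !≢0}}) (trans eq (trans (cong -_ product)
          (trans (sym (ℤ-neg≡- _)) (ℤₚ.neg-distribˡ-* (ℤ.+ (h ℕ.^ k)) (ℤ.+ (N !)))))))
        (trans (quotient-of (ℤ.- (ℤ.+ (h ℕ.^ k)))) (trans (-/1 (ℤ.+ (h ℕ.^ k))) (cong ℚ.-_ (sym value))))))

open import Defs
open import Data.Nat using (ℕ; _≤_; _/_; _∸_; _*_)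
open import Data.Nat.Properties using ()
open import Data.Nat.Divisibility using (_∣_)
open import Data.Rational using (-_)
open import Data.Sum using (_⊎_)
open import Relation.Binary.PropositionalEquality using (_≡_)

open import Data.Nat using (zero; suc)
open import Data.Nat.Divisibility using (divides)
open import Data.Nat.DivMod using (m*n/n≡m)
open import Relation.Binary.PropositionalEquality using (refl; sym; subst)

theorem1p4 : (d n : ℕ) → 2 ∣ d → 2 ≤ d → 1 ≤ n →
    (hyperdet d (n * n) (Mn d n) ≡ powℚ (hookProd n) (d / 2 ∸ 1))
    ⊎ (hyperdet d (n * n) (Mn d n) ≡ - powℚ (hookProd n) (d / 2 ∸ 1))
-- Here `d` is `suc k * 2`, which computes to `suc (suc (k * 2))`, and the exponent `d / 2 ∸ 1`
-- becomes `k` once the quotient is rewritten to `suc k`.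
theorem1p4 d n (divides (suc k) refl) 2≤d 1≤n =
  subst (λ e → (hyperdet d (n * n) (Mn d n) ≡ powℚ (hookProd n) (e ∸ 1))
             ⊎ (hyperdet d (n * n) (Mn d n) ≡ - powℚ (hookProd n) (e ∸ 1)))
    (sym (m*n/n≡m (suc k) 2)) (Development.hyperdet-even k n)
theorem1p4 d n (divides zero refl) () 1≤n
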